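{- Let $m,d$ be positive integers and let $U_{m,d}$ be the uniform matroid of rank $d$ on $m+d$ elements. Let $z_{m,d}^i$ denote the coefficient of $t^i$ in the $Z$-polynomial $Z_{U_{m,d}}(t)$. Then for every $0\le i\le d$, \[ z_{m,d}^i=\frac{\binom{d+m}{i+m}\binom{d+m}{i}}{\binom{d+m}{m}}\sum_{h=0}^{m-1}\frac{i(h-m+1)+m}{(h+1)m}\binom{i-1+h}{h}\binom{d-i+h}{h}. \]
   Context: Binomial coefficients are $\binom{x}{h}=x(x-1)\cdots(x-h+1)/h!$ for integers $h\ge 0$ (so $\binom{ -1}{0}=1$). For a loopless matroid $M$ with lattice of flats $L(M)$, characteristic polynomial $\chi_M(t)$ and rank $\operatorname{rk}M$, the Kazhdan–Lusztig polynomial $P_M(t)$ is the unique assignment with $P_M=1$ if $\operatorname{rk}M=0$, $\deg P_M<\frac12\operatorname{rk}M$ if $\operatorname{rk}M>0$, and $t^{\operatorname{rk}M}P_M(t^{ -1})=\sum_{F\in L(M)}\chi_{M_F}(t)P_{M^F}(t)$, where $M_F$ is the restriction of $M$ to the flat $F$ and $M^F$ is the contraction of $M$ by $F$. The $Z$-polynomial is $Z_M(t)=\sum_{F\in L(M)}t^{\operatorname{rk}M_F}P_{M^F}(t)$. -}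

module Defs where

open import Data.Nat as ℕ using (ℕ; zero; suc; _≤_; _<_; _∸_; _⊓_; _!; _≤ᵇ_)
import Data.Nat.Properties as ℕP
open import Data.Integer as ℤ using (ℤ; +_)
open import Data.Rational as ℚ using (ℚ)
open import Data.Bool using (Bool; true; false; if_then_else_)
open import Data.List using (List; []; _∷_; _++_; map; upTo)
open import Data.Vec using ([]; _∷_)
open import Data.Fin using (Fin)
open import Data.Fin.Subset using (Subset; inside; outside; _⊆_; _∈_; _∉_; _∪_; _∩_; _─_; ⁅_⁆; ∣_∣; ⊤)
open import Data.Fin.Subset.Properties using (_⊆?_; _∈?_)
open import Data.Product using (_×_)
open import Relation.Nullary using (Dec; yes; no; does; _×-dec_; _→-dec_)
open import Data.Fin.Properties using (all?)

subsets : (n : ℕ) → List (Subset n)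
subsets zero = [] ∷ []
subsets (suc n) = map (outside ∷_) (subsets n) ++ map (inside ∷_) (subsets n)

sumℤ : List ℤ → ℤ
sumℤ [] = + 0
sumℤ (x ∷ xs) = x ℤ.+ sumℤ xs

sumℚ : List ℚ → ℚ
sumℚ [] = ℚ.0ℚ
sumℚ (x ∷ xs) = x ℚ.+ sumℚ xs

-- Polynomials with integer coefficients, as coefficient functions
-- (p k = coefficient of t^k)

Poly : Set
Poly = ℕ → ℤ

onePoly : Poly
onePoly zero = + 1
onePoly (suc _) = + 0

_⋆_ : Poly → Poly → Poly
(f ⋆ g) k = sumℤ (map (λ j → f j ℤ.* g (k ∸ j)) (upTo (suc k)))

-- t^r p(t^{-1})  (a polynomial when deg p ≤ r)
rev : ℕ → Poly → Poly
rev r p k = if k ≤ᵇ r then p (r ∸ k) else + 0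

shift : ℕ → Poly → Poly
shift s p k = if s ≤ᵇ k then p (k ∸ s) else + 0

-- Matroids, given by rank functions.  A matroid is represented inside an
-- ambient finite set Fin n: its ground set is E ⊆ Fin n and its rank
-- function is rk restricted to subsets of E.  This lets restrictions
-- and contractions be formed without relabelling.

record Mat : Set where
  constructor mat
  field
    n  : ℕ
    E  : Subset n
    rk : Subset n → ℕ
open Mat public

record IsMatroid (M : Mat) : Set where
  field
    bounded    : ∀ A → A ⊆ E M → rk M A ≤ ∣ A ∣
    monotone   : ∀ A B → A ⊆ B → B ⊆ E M → rk M A ≤ rk M B
    submodular : ∀ A B → A ⊆ E M → B ⊆ E M →
                 rk M (A ∪ B) ℕ.+ rk M (A ∩ B) ≤ rk M A ℕ.+ rk M B

Loopless : Mat → Set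
Loopless M = ∀ x → x ∈ E M → rk M ⁅ x ⁆ ≡′ 1
  where open import Relation.Binary.PropositionalEquality renaming (_≡_ to _≡′_)

rank : Mat → ℕ
rank M = rk M (E M)

IsFlat : (M : Mat) → Subset (n M) → Set
IsFlat M F = F ⊆ E M × (∀ x → x ∈ E M → x ∉ F → rk M F < rk M (F ∪ ⁅ x ⁆))

isFlat? : (M : Mat) (F : Subset (n M)) → Dec (IsFlat M F)
isFlat? M F = (F ⊆? E M) ×-dec all? (λ x → (x ∈? E M) →-dec ((x ∈? F →-dec no (λ z → z)) →-dec (ℕ.suc (rk M F) ℕP.≤? rk M (F ∪ ⁅ x ⁆))))

sumFlats : (M : Mat) → (Subset (n M) → ℤ) → ℤ
sumFlats M f = sumℤ (map (λ F → if does (isFlat? M F) then f F else + 0) (subsets (n M)))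

restrict : (M : Mat) → Subset (n M) → Mat
restrict M F = mat (n M) F (rk M)

contract : (M : Mat) → Subset (n M) → Mat
contract M F = mat (n M) (E M ─ F) (λ A → rk M (A ∪ F) ∸ rk M F)

sign : ℕ → ℤ
sign zero = + 1
sign (suc k) = ℤ.- sign k

χ : Mat → Poly
χ M k = sumℤ (map (λ A → if does (A ⊆? E M)
                            then (if does ((rank M ∸ rk M A) ℕ.≟ k) then sign ∣ A ∣ else + 0)
                            else + 0)
                  (subsets (n M)))

IsKL : (Mat → Poly) → Set
IsKL P = ∀ M → IsMatroid M → Loopless M →
    (rank M ≡′ 0 → ∀ k → P M k ≡′ onePoly k)
  × (0 < rank M → ∀ k → rank M ≤ 2 ℕ.* k → P M k ≡′ + 0)
  × (∀ k → rev (rank M) (P M) k ≡′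
           sumFlats M (λ F → (χ (restrict M F) ⋆ P (contract M F)) k))
  where open import Relation.Binary.PropositionalEquality renaming (_≡_ to _≡′_)

Z : (Mat → Poly) → Mat → Poly
Z P M k = sumFlats M (λ F → shift (rk M F) (P (contract M F)) k)

U : ℕ → ℕ → Mat
U m d = mat (m ℕ.+ d) ⊤ (λ A → ∣ A ∣ ⊓ d)

-- division by a natural number (only ever used with nonzero divisors;
-- the value at 0 is an irrelevant convention)
_÷ℕ_ : ℚ → ℕ → ℚ
p ÷ℕ zero = ℚ.0ℚ
p ÷ℕ suc k = p ℚ.* (+ 1 ℚ./ suc k)

falling : ℤ → ℕ → ℤ
falling x zero = + 1
falling x (suc h) = falling x h ℤ.* (x ℤ.- + h)

binom : ℤ → ℕ → ℚ
binom x h = (falling x h ℚ./ 1) ÷ℕ (h !)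

ℤtoℚ : ℤ → ℚ
ℤtoℚ x = x ℚ./ 1

{-# OPTIONS --safe #-}

-- Put e = d - i and z(e, i) = z_{m,e+i}^i.  The defining recursion of P makes Z palindromic, so z(e, i) = z(i, e).
-- Since deg P < rk / 2, for e > 0 the quotient z(e, i) i! / (m+e+i)! is a polynomial in i of degree less than e: it
-- is the sum over j < e of the binomial coefficients (i choose j) with coefficients coming from P.  Hence z is
-- determined by symmetry and by z(0, i) = 1: its e-th row is interpolated from the rows above it.
-- The claimed formula has the same properties: m times its sum equals the symmetric expression
--   Σ_{h<m} (m-h) (i-1+h choose h) (e-1+h choose h),
-- and Vandermonde's identity rewrites this as Σ_{l<e} (e-1 choose l) (i-1+l choose l) (i+m choose i+l+1), whose
-- product with (i+e)! / (i+m)! is visibly a polynomial in i of degree less than e.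

module Submission where

open import Defs
open import Data.Nat using (ℕ; _≤_; _+_; _*_)
open import Data.Nat.Combinatorics using (_C_)
import Data.Integer as Z
import Data.Rational as Q
open import Data.List using (map; upTo)
open import Relation.Binary.PropositionalEquality using (_≡_)

open import Data.Bool using (true; false; if_then_else_)
open import Data.Fin using (Fin; zero; suc)
open import Data.Fin.Subset using (Subset; inside; outside; _⊆_; _∈_; _∉_; _∪_; _∩_; _─_; ⁅_⁆; ∣_∣)
open import Data.Fin.Subset.Properties as SubP using (_⊆?_; _∈?_)
open import Data.Integer using (ℤ) renaming (_+_ to _+ℤ_; _*_ to _*ℤ_; -_ to -ℤ_; _-_ to _-ℤ_)
import Data.Integer.Properties as ℤP
open import Data.Integer.Solver using () renaming (module +-*-Solver to ℤSolver)
open import Data.List using ([]; _∷_; _++_; applyUpTo)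
import Data.List.Properties as ListP
open import Data.Nat using (zero; suc; _<_; _∸_; _⊓_; _!; z≤n; s≤s; _≟_; _<?_; _≤?_; NonZero)
open import Data.Nat.Combinatorics using (nCn≡1; nCk≡nC[n∸k]; nCk+nC[k+1]≡[n+1]C[k+1]; k>n⇒nCk≡0)
open import Data.Nat.Induction using (<-rec)
import Data.Nat.Properties as ℕP
open import Data.Nat.Solver using () renaming (module +-*-Solver to ℕSolver)
open import Data.Product using (_,_; proj₁; proj₂)
open import Data.Rational using (ℚ; 0ℚ; 1ℚ; toℚᵘ) renaming (_+_ to _+ℚ_; _*_ to _*ℚ_; -_ to -ℚ_; _-_ to _-ℚ_)
import Data.Rational.Properties as ℚP
open import Data.Rational.Solver using () renaming (module +-*-Solver to ℚSolver)
open import Data.Rational.Unnormalised as ℚᵘ using (mkℚᵘ; *≡*)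
import Data.Rational.Unnormalised.Properties as ℚᵘP
open import Data.Sum using (inj₁; inj₂)
open import Data.Vec using ([]; _∷_; here; there)
open import Function using (_∘_; id)
open import Relation.Binary.PropositionalEquality using (refl; sym; trans; cong; cong₂; subst; module ≡-Reasoning)
open import Relation.Nullary using (¬_; Dec; yes; no; does; contradiction)

-- Binomial sums and subsets

-- No coefficient of P is ever computed: beyond the degree bound they stay unknown constants of an
-- interpolation. Three obstacles shape the rest. `P` acts on representations of matroids and is not
-- assumed invariant under isomorphism, while a contraction of `U m d` is not literally some
-- `U m d′`; hence the recursion itself has to yield that `P` sees only m and the rank (`P-unique`).
-- Palindromicity comes from inserting the recursion into every term of t^d Z(1/t) and exchanging
-- the two sums: for a fixed proper flat G, the polynomials (t-1)^(|G|-|F|) over F ⊆ G add up to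
-- t^|G|. Since everything depends on cardinalities only, sums over flats become binomial sums over
-- all subsets, where sizes that carry no flat get the summand 0 and the ground set is treated
-- apart. Finally, the stated sum hides its symmetry in i and d - i; its weights are really
-- differences in h, and summation by parts brings the symmetry out.

if-yes : ∀ {A B : Set} (D : Dec A) {x y : B} → A → (if does D then x else y) ≡ x
if-yes (yes _) _ = refl
if-yes (no ¬a) a = contradiction a ¬a

if-no : ∀ {A B : Set} (D : Dec A) {x y : B} → ¬ A → (if does D then x else y) ≡ y
if-no (yes a) ¬a = contradiction a ¬a
if-no (no _) _ = refl

+ℤ-interchange : ∀ a b c d → (a +ℤ b) +ℤ (c +ℤ d) ≡ (a +ℤ c) +ℤ (b +ℤ d)
+ℤ-interchange = solve 4 (λ a b c d → (a :+ b) :+ (c :+ d) := (a :+ c) :+ (b :+ d)) refl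
  where open ℤSolver

-- bsum n g = Σ_{a + b = n} (n choose a) g(a, b), in the form in which it
-- arises from summing over the subsets of an n-element set.
bsum : ℕ → (ℕ → ℕ → ℤ) → ℤ
bsum zero    g = g 0 0
bsum (suc n) g = bsum n (λ a b → g (suc a) b) +ℤ bsum n (λ a b → g a (suc b))

bsum-cong : ∀ n {f g : ℕ → ℕ → ℤ} → (∀ a b → a + b ≡ n → f a b ≡ g a b) → bsum n f ≡ bsum n g
bsum-cong zero    f≗g = f≗g 0 0 refl
bsum-cong (suc n) f≗g = cong₂ _+ℤ_
  (bsum-cong n (λ a b eq → f≗g (suc a) b (cong suc eq)))
  (bsum-cong n (λ a b eq → f≗g a (suc b) (trans (ℕP.+-suc a b) (cong suc eq))))

bsum-+ : ∀ n (f g : ℕ → ℕ → ℤ) → bsum n (λ a b → f a b +ℤ g a b) ≡ bsum n f +ℤ bsum n g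
bsum-+ zero    f g = refl
bsum-+ (suc n) f g = trans
  (cong₂ _+ℤ_ (bsum-+ n (λ a b → f (suc a) b) (λ a b → g (suc a) b))
              (bsum-+ n (λ a b → f a (suc b)) (λ a b → g a (suc b))))
  (+ℤ-interchange (bsum n (λ a b → f (suc a) b)) (bsum n (λ a b → g (suc a) b))
               (bsum n (λ a b → f a (suc b))) (bsum n (λ a b → g a (suc b))))

bsum-zero : ∀ n → bsum n (λ _ _ → Z.+ 0) ≡ Z.+ 0
bsum-zero zero    = refl
bsum-zero (suc n) = cong₂ _+ℤ_ (bsum-zero n) (bsum-zero n)

bsum-*ʳ : ∀ n (f : ℕ → ℕ → ℤ) c → bsum n (λ a b → f a b *ℤ c) ≡ bsum n f *ℤ c
bsum-*ʳ zero    f c = refl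
bsum-*ʳ (suc n) f c = trans
  (cong₂ _+ℤ_ (bsum-*ʳ n (λ a b → f (suc a) b) c) (bsum-*ʳ n (λ a b → f a (suc b)) c))
  (sym (ℤP.*-distribʳ-+ c (bsum n (λ a b → f (suc a) b)) (bsum n (λ a b → f a (suc b)))))

-- Both sides sum over ordered partitions of an n-element set into parts of sizes a, c, e: either
-- the first part is chosen and then the second from the rest, or their union is chosen and then
-- split.
bsum-assoc : ∀ n (g : ℕ → ℕ → ℕ → ℤ) →
  bsum n (λ a b → bsum b (λ c e → g a c e)) ≡ bsum n (λ s e → bsum s (λ a c → g a c e))
bsum-assoc zero    g = refl
bsum-assoc (suc n) g = begin
  bsum n (λ a b → bsum b (g (suc a))) +ℤ
    bsum n (λ a b → bsum b (λ c e → g a (suc c) e) +ℤ bsum b (λ c e → g a c (suc e)))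
    ≡⟨ cong (bsum n (λ a b → bsum b (g (suc a))) +ℤ_)
         (bsum-+ n (λ a b → bsum b (λ c e → g a (suc c) e)) (λ a b → bsum b (λ c e → g a c (suc e)))) ⟩
  bsum n (λ a b → bsum b (g (suc a))) +ℤ
    (bsum n (λ a b → bsum b (λ c e → g a (suc c) e)) +ℤ bsum n (λ a b → bsum b (λ c e → g a c (suc e))))
    ≡⟨ cong₂ _+ℤ_ (bsum-assoc n (λ a c e → g (suc a) c e))
         (cong₂ _+ℤ_ (bsum-assoc n (λ a c e → g a (suc c) e)) (bsum-assoc n (λ a c e → g a c (suc e)))) ⟩
  x₁ +ℤ (x₂ +ℤ x₃)
    ≡⟨ sym (ℤP.+-assoc x₁ x₂ x₃) ⟩
  (x₁ +ℤ x₂) +ℤ x₃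
    ≡⟨ cong (_+ℤ x₃) (sym (bsum-+ n (λ s e → bsum s (λ a c → g (suc a) c e)) (λ s e → bsum s (λ a c → g a (suc c) e)))) ⟩
  bsum n (λ s e → bsum s (λ a c → g (suc a) c e) +ℤ bsum s (λ a c → g a (suc c) e)) +ℤ x₃ ∎
  where
  open ≡-Reasoning
  x₁ = bsum n (λ s e → bsum s (λ a c → g (suc a) c e))
  x₂ = bsum n (λ s e → bsum s (λ a c → g a (suc c) e))
  x₃ = bsum n (λ s e → bsum s (λ a c → g a c (suc e)))

δ : ℕ → ℕ → ℤ
δ x k = if does (x ≟ k) then Z.+ 1 else Z.+ 0

bsum-sign : ∀ n → bsum n (λ _ b → sign b) ≡ δ n 0
bsum-sign zero    = refl
bsum-sign (suc n) = trans (sym (bsum-+ n (λ _ b → sign b) (λ _ b → -ℤ sign b)))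
  (trans (bsum-cong n (λ _ b _ → ℤP.+-inverseʳ (sign b))) (bsum-zero n))

bsum-δˡ : ∀ n (c : ℕ → ℤ) → bsum n (λ a b → δ a 0 *ℤ c b) ≡ c n
bsum-δˡ zero    c = ℤP.*-identityˡ (c 0)
bsum-δˡ (suc n) c = trans
  (cong₂ _+ℤ_ (trans (bsum-cong n (λ _ b _ → ℤP.*-zeroˡ (c b))) (bsum-zero n)) (bsum-δˡ n (λ b → c (suc b))))
  (ℤP.+-identityˡ (c (suc n)))

bsum-δʳ : ∀ n v → bsum n (λ a b → δ b 0 *ℤ v) ≡ v
bsum-δʳ zero    v = ℤP.*-identityˡ v
bsum-δʳ (suc n) v = trans
  (cong₂ _+ℤ_ (bsum-δʳ n v) (trans (bsum-cong n (λ _ _ _ → ℤP.*-zeroˡ v)) (bsum-zero n)))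
  (ℤP.+-identityʳ v)

-- Binomial inversion: after `bsum-assoc` the signs run over all subsets of an s-element set, and
-- they cancel unless s = 0.
bsum-inversion : ∀ n (c : ℕ → ℤ) → bsum n (λ _ b → bsum b (λ a b′ → sign a *ℤ c b′)) ≡ c n
bsum-inversion n c = trans (bsum-assoc n (λ _ a b → sign a *ℤ c b))
  (trans (bsum-cong n (λ s e _ → trans (bsum-*ʳ s (λ _ b → sign b) (c e)) (cong (_*ℤ c e) (bsum-sign s))))
         (bsum-δˡ n c))

sumℤ-++ : ∀ xs ys → sumℤ (xs ++ ys) ≡ sumℤ xs +ℤ sumℤ ys
sumℤ-++ []       ys = sym (ℤP.+-identityˡ (sumℤ ys))
sumℤ-++ (x ∷ xs) ys = trans (cong (x +ℤ_) (sumℤ-++ xs ys)) (sym (ℤP.+-assoc x (sumℤ xs) (sumℤ ys)))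

sumℤ-zero : ∀ {A : Set} (t : A → ℤ) → (∀ x → t x ≡ Z.+ 0) → ∀ xs → sumℤ (map t xs) ≡ Z.+ 0
sumℤ-zero t t≗0 []       = refl
sumℤ-zero t t≗0 (x ∷ xs) = cong₂ _+ℤ_ (t≗0 x) (sumℤ-zero t t≗0 xs)

sum-subsets-suc : ∀ n (t : Subset (suc n) → ℤ) → sumℤ (map t (subsets (suc n))) ≡
  sumℤ (map (λ A → t (outside ∷ A)) (subsets n)) +ℤ sumℤ (map (λ A → t (inside ∷ A)) (subsets n))
sum-subsets-suc n t = trans
  (cong sumℤ (ListP.map-++ t (map (outside ∷_) (subsets n)) (map (inside ∷_) (subsets n))))
  (trans (sumℤ-++ (map t (map (outside ∷_) (subsets n))) _)
         (cong₂ (λ xs ys → sumℤ xs +ℤ sumℤ ys) (sym (ListP.map-∘ (subsets n))) (sym (ListP.map-∘ (subsets n)))))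

-- An element outside E can only be omitted; an element of E raises either the size or the cosize of
-- A, which is exactly the recursion of `bsum`.
sum-subsets : ∀ {n} (E : Subset n) (t : Subset n → ℤ) (g : ℕ → ℕ → ℤ) →
  (∀ A → A ⊆ E → t A ≡ g ∣ A ∣ (∣ E ∣ ∸ ∣ A ∣)) → (∀ A → ¬ (A ⊆ E) → t A ≡ Z.+ 0) →
  sumℤ (map t (subsets n)) ≡ bsum ∣ E ∣ g
sum-subsets []            t g t⊆ t⊈ = trans (ℤP.+-identityʳ (t [])) (t⊆ [] id)
sum-subsets {suc n} (outside ∷ E) t g t⊆ t⊈ = trans (sum-subsets-suc n t)
  (trans (cong₂ _+ℤ_
    (sum-subsets E (λ A → t (outside ∷ A)) g (λ A A⊆E → t⊆ (outside ∷ A) (SubP.out⊆ A⊆E))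
      (λ A A⊈E → t⊈ (outside ∷ A) (λ s → A⊈E (SubP.drop-∷-⊆ s))))
    (sumℤ-zero _ (λ A → t⊈ (inside ∷ A) (λ s → contradiction (s here) λ ())) (subsets n)))
  (ℤP.+-identityʳ _))
sum-subsets {suc n} (inside ∷ E)  t g t⊆ t⊈ = trans (sum-subsets-suc n t)
  (trans (cong₂ _+ℤ_
    (sum-subsets E (λ A → t (outside ∷ A)) (λ a b → g a (suc b))
      (λ A A⊆E → trans (t⊆ (outside ∷ A) (SubP.out⊆ A⊆E))
                       (cong (g ∣ A ∣) (ℕP.+-∸-assoc 1 (SubP.p⊆q⇒∣p∣≤∣q∣ A⊆E))))
      (λ A A⊈E → t⊈ (outside ∷ A) (λ s → A⊈E (SubP.drop-∷-⊆ s))))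
    (sum-subsets E (λ A → t (inside ∷ A)) (λ a b → g (suc a) b)
      (λ A A⊆E → t⊆ (inside ∷ A) (SubP.in⊆in A⊆E))
      (λ A A⊈E → t⊈ (inside ∷ A) (λ s → A⊈E (SubP.drop-∷-⊆ s)))))
  (ℤP.+-comm (bsum ∣ E ∣ (λ a b → g a (suc b))) (bsum ∣ E ∣ (λ a b → g (suc a) b))))

∣∪∣+∣∩∣ : ∀ {n} (A B : Subset n) → ∣ A ∪ B ∣ + ∣ A ∩ B ∣ ≡ ∣ A ∣ + ∣ B ∣
∣∪∣+∣∩∣ []            []            = refl
∣∪∣+∣∩∣ (outside ∷ A) (outside ∷ B) = ∣∪∣+∣∩∣ A B
∣∪∣+∣∩∣ (outside ∷ A) (inside ∷ B)  = trans (cong suc (∣∪∣+∣∩∣ A B)) (sym (ℕP.+-suc ∣ A ∣ ∣ B ∣))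
∣∪∣+∣∩∣ (inside ∷ A)  (outside ∷ B) = cong suc (∣∪∣+∣∩∣ A B)
∣∪∣+∣∩∣ (inside ∷ A)  (inside ∷ B)  = cong suc
  (trans (ℕP.+-suc ∣ A ∪ B ∣ ∣ A ∩ B ∣) (trans (cong suc (∣∪∣+∣∩∣ A B)) (sym (ℕP.+-suc ∣ A ∣ ∣ B ∣))))

∣∪⁅x⁆∣ : ∀ {n} (F : Subset n) x → x ∉ F → ∣ F ∪ ⁅ x ⁆ ∣ ≡ suc ∣ F ∣
∣∪⁅x⁆∣ (outside ∷ F) zero    x∉F = cong (suc ∘ ∣_∣) (SubP.∪-identityʳ F)
∣∪⁅x⁆∣ (inside ∷ F)  zero    x∉F = contradiction here x∉F
∣∪⁅x⁆∣ (outside ∷ F) (suc x) x∉F = ∣∪⁅x⁆∣ F x (x∉F ∘ there)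
∣∪⁅x⁆∣ (inside ∷ F)  (suc x) x∉F = cong suc (∣∪⁅x⁆∣ F x (x∉F ∘ there))

∣─∣ : ∀ {n} (E F : Subset n) → F ⊆ E → ∣ E ─ F ∣ + ∣ F ∣ ≡ ∣ E ∣
∣─∣ []            []            F⊆E = refl
∣─∣ (outside ∷ E) (outside ∷ F) F⊆E = ∣─∣ E F (SubP.drop-∷-⊆ F⊆E)
∣─∣ (inside ∷ E)  (outside ∷ F) F⊆E = cong suc (∣─∣ E F (SubP.drop-∷-⊆ F⊆E))
∣─∣ (outside ∷ E) (inside ∷ F)  F⊆E = contradiction (F⊆E here) λ ()
∣─∣ (inside ∷ E)  (inside ∷ F)  F⊆E =
  trans (ℕP.+-suc ∣ E ─ F ∣ ∣ F ∣) (cong suc (∣─∣ E F (SubP.drop-∷-⊆ F⊆E)))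

∣∪∣-disjoint : ∀ {n} (A E F : Subset n) → A ⊆ E ─ F → ∣ A ∪ F ∣ ≡ ∣ A ∣ + ∣ F ∣
∣∪∣-disjoint []            []      []            A⊆ = refl
∣∪∣-disjoint (outside ∷ A) (_ ∷ E) (outside ∷ F) A⊆ = ∣∪∣-disjoint A E F (SubP.drop-∷-⊆ A⊆)
∣∪∣-disjoint (inside ∷ A)  (_ ∷ E) (outside ∷ F) A⊆ = cong suc (∣∪∣-disjoint A E F (SubP.drop-∷-⊆ A⊆))
∣∪∣-disjoint (outside ∷ A) (_ ∷ E) (inside ∷ F)  A⊆ =
  trans (cong suc (∣∪∣-disjoint A E F (SubP.drop-∷-⊆ A⊆))) (sym (ℕP.+-suc ∣ A ∣ ∣ F ∣))
∣∪∣-disjoint (inside ∷ A)  (_ ∷ E) (inside ∷ F)  A⊆ = contradiction (A⊆ here) λ ()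

⊆-∪ : ∀ {n} {A B E : Subset n} → A ⊆ E → B ⊆ E → A ∪ B ⊆ E
⊆-∪ {A = A} {B} A⊆E B⊆E x∈ with SubP.x∈p∪q⁻ A B x∈
... | inj₁ x∈A = A⊆E x∈A
... | inj₂ x∈B = B⊆E x∈B

⁅x⁆⊆ : ∀ {n} {x : Fin n} {E : Subset n} → x ∈ E → ⁅ x ⁆ ⊆ E
⁅x⁆⊆ {E = E} x∈E y∈ = subst (_∈ E) (sym (SubP.x∈⁅y⁆⇒x≡y _ y∈)) x∈E

-- Uniform matroids

-- Contractions of U m d are not literally of the form U m d′, as they live on
-- part of the ambient set; hence uniformity as a property.
record IsUniform (M : Mat) (m d : ℕ) : Set where
  field
    ∣E∣≡ : ∣ E M ∣ ≡ m + d
    rk≡  : ∀ A → A ⊆ E M → rk M A ≡ ∣ A ∣ ⊓ d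

U-uniform : ∀ m d → IsUniform (U m d) m d
U-uniform m d = record { ∣E∣≡ = SubP.∣⊤∣≡n (m + d) ; rk≡ = λ _ _ → refl }

-- Here x and y stand for the sizes of union and intersection. If neither a nor b is truncated,
-- cardinality is modular; if one is, it already has the value d, which bounds x ⊓ d, and y is
-- compared with the other.
⊓-submodular : ∀ {a b x y} d → x + y ≡ a + b → y ≤ a → y ≤ b → x ⊓ d + y ⊓ d ≤ a ⊓ d + b ⊓ d
⊓-submodular {a} {b} {x} {y} d eq y≤a y≤b with ℕP.≤-total a d | ℕP.≤-total b d
... | inj₁ a≤d | inj₁ b≤d rewrite ℕP.m≤n⇒m⊓n≡m a≤d | ℕP.m≤n⇒m⊓n≡m b≤d =
      ℕP.≤-trans (ℕP.+-mono-≤ (ℕP.m⊓n≤m x d) (ℕP.m⊓n≤m y d)) (ℕP.≤-reflexive eq)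
... | inj₂ d≤a | _ rewrite ℕP.m≥n⇒m⊓n≡n d≤a = ℕP.+-mono-≤ (ℕP.m⊓n≤n x d) (ℕP.⊓-monoˡ-≤ d y≤b)
... | inj₁ _ | inj₂ d≤b rewrite ℕP.m≥n⇒m⊓n≡n d≤b | ℕP.+-comm (a ⊓ d) d =
      ℕP.+-mono-≤ (ℕP.m⊓n≤n x d) (ℕP.⊓-monoˡ-≤ d y≤a)

m+n⊓n≡n : ∀ m n → (m + n) ⊓ n ≡ n
m+n⊓n≡n m n = ℕP.m≥n⇒m⊓n≡n (ℕP.m≤n+m n m)

+-⊓-∸ : ∀ x a d → a ≤ d → (x + a) ⊓ d ∸ a ⊓ d ≡ x ⊓ (d ∸ a)
+-⊓-∸ x a d a≤d = begin
  (x + a) ⊓ d ∸ a ⊓ d        ≡⟨ cong ((x + a) ⊓ d ∸_) (ℕP.m≤n⇒m⊓n≡m a≤d) ⟩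
  (x + a) ⊓ d ∸ a            ≡⟨ ℕP.∸-distribʳ-⊓ a (x + a) d ⟩
  (x + a ∸ a) ⊓ (d ∸ a)      ≡⟨ cong (_⊓ (d ∸ a)) (ℕP.m+n∸n≡m x a) ⟩
  x ⊓ (d ∸ a) ∎
  where open ≡-Reasoning

module Uniform {M m d} (u : IsUniform M m d) where
  open IsUniform u public

  isMatroid : IsMatroid M
  isMatroid = record
    { bounded = λ A A⊆E → subst (_≤ ∣ A ∣) (sym (rk≡ A A⊆E)) (ℕP.m⊓n≤m ∣ A ∣ d)
    ; monotone = λ A B A⊆B B⊆E → ℕP.≤-trans (ℕP.≤-reflexive (rk≡ A (B⊆E ∘ A⊆B)))
        (ℕP.≤-trans (ℕP.⊓-monoˡ-≤ d (SubP.p⊆q⇒∣p∣≤∣q∣ A⊆B)) (ℕP.≤-reflexive (sym (rk≡ B B⊆E))))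
    ; submodular = λ A B A⊆E B⊆E → ℕP.≤-trans
        (ℕP.≤-reflexive (cong₂ _+_ (rk≡ (A ∪ B) (⊆-∪ A⊆E B⊆E)) (rk≡ (A ∩ B) (A⊆E ∘ SubP.p∩q⊆p A B))))
        (ℕP.≤-trans
          (⊓-submodular d (∣∪∣+∣∩∣ A B) (SubP.∣p∩q∣≤∣p∣ A B) (SubP.∣p∩q∣≤∣q∣ A B))
          (ℕP.≤-reflexive (sym (cong₂ _+_ (rk≡ A A⊆E) (rk≡ B B⊆E)))))
    }

  -- In rank 0 every element is a loop, so the ground set must be empty. The pair (0, 0) arises from
  -- contracting the whole ground set (`contract-full`).
  loopless : (d ≡ 0 → m ≡ 0) → Loopless M
  loopless d≡0⇒m≡0 x x∈E = trans (rk≡ ⁅ x ⁆ (⁅x⁆⊆ x∈E))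
    (trans (cong (_⊓ d) (SubP.∣⁅x⁆∣≡1 x)) (1⊓d≡1 d refl))
    where
    1⊓d≡1 : ∀ d′ → d ≡ d′ → 1 ⊓ d′ ≡ 1
    1⊓d≡1 (suc d′) _ = refl
    1⊓d≡1 zero d≡0 = contradiction
      (subst (1 ≤_) (trans ∣E∣≡ (cong₂ _+_ (d≡0⇒m≡0 d≡0) d≡0))
        (subst (_≤ ∣ E M ∣) (SubP.∣⁅x⁆∣≡1 x) (SubP.p⊆q⇒∣p∣≤∣q∣ (⁅x⁆⊆ {E = E M} x∈E)))) λ ()

  rank≡ : rank M ≡ d
  rank≡ = trans (rk≡ (E M) id) (trans (cong (_⊓ d) ∣E∣≡) (m+n⊓n≡n m d))

  ∣F∣≤ : ∀ {F} → F ⊆ E M → ∣ F ∣ ≤ m + d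
  ∣F∣≤ {F} F⊆E = subst (∣ F ∣ ≤_) ∣E∣≡ (SubP.p⊆q⇒∣p∣≤∣q∣ F⊆E)

  contract-uniform : ∀ F → F ⊆ E M → ∣ F ∣ < d → IsUniform (contract M F) m (d ∸ ∣ F ∣)
  contract-uniform F F⊆E ∣F∣<d = record
    { ∣E∣≡ = ℕP.+-cancelʳ-≡ ∣ F ∣ _ _ (trans (∣─∣ (E M) F F⊆E) (trans ∣E∣≡ (sym
        (trans (ℕP.+-assoc m (d ∸ ∣ F ∣) ∣ F ∣) (cong (λ x → m + x) (ℕP.m∸n+n≡m (ℕP.<⇒≤ ∣F∣<d)))))))
    ; rk≡ = λ A A⊆ → trans
        (cong₂ _∸_ (trans (rk≡ (A ∪ F) (⊆-∪ (SubP.p─q⊆p (E M) F ∘ A⊆) F⊆E))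
                          (cong (_⊓ d) (∣∪∣-disjoint A (E M) F A⊆)))
                   (rk≡ F F⊆E))
        (+-⊓-∸ ∣ A ∣ ∣ F ∣ d (ℕP.<⇒≤ ∣F∣<d))
    }

  contract-full : ∀ F → F ⊆ E M → ∣ F ∣ ≡ m + d → IsUniform (contract M F) 0 0
  contract-full F F⊆E ∣F∣≡ = record
    { ∣E∣≡ = ℕP.+-cancelʳ-≡ ∣ F ∣ _ _ (trans (∣─∣ (E M) F F⊆E) (trans ∣E∣≡ (sym ∣F∣≡)))
    ; rk≡ = λ A A⊆ → trans
        (cong₂ _∸_ (rk≡ (A ∪ F) (⊆-∪ (SubP.p─q⊆p (E M) F ∘ A⊆) F⊆E)) (rk≡ F F⊆E))
        (trans (ℕP.m≤n⇒m∸n≡0 (ℕP.≤-trans (ℕP.m⊓n≤n ∣ A ∪ F ∣ d)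
                 (ℕP.≤-reflexive (sym (trans (cong (_⊓ d) ∣F∣≡) (m+n⊓n≡n m d))))))
               (sym (ℕP.⊓-zeroʳ ∣ A ∣)))
    }

  rk-∪⁅x⁆ : ∀ F x → F ⊆ E M → x ∈ E M → x ∉ F → rk M (F ∪ ⁅ x ⁆) ≡ suc ∣ F ∣ ⊓ d
  rk-∪⁅x⁆ F x F⊆E x∈E x∉F =
    trans (rk≡ (F ∪ ⁅ x ⁆) (⊆-∪ F⊆E (⁅x⁆⊆ x∈E))) (cong (_⊓ d) (∣∪⁅x⁆∣ F x x∉F))

  small-flat : ∀ F → F ⊆ E M → ∣ F ∣ < d → IsFlat M F
  small-flat F F⊆E ∣F∣<d = F⊆E , λ x x∈E x∉F → subst (_≤ rk M (F ∪ ⁅ x ⁆))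
    (sym (cong suc (trans (rk≡ F F⊆E) (ℕP.m≤n⇒m⊓n≡m (ℕP.<⇒≤ ∣F∣<d)))))
    (ℕP.≤-reflexive (sym (trans (rk-∪⁅x⁆ F x F⊆E x∈E x∉F) (ℕP.m≤n⇒m⊓n≡m ∣F∣<d))))

  full-flat : ∀ F → F ⊆ E M → ∣ F ∣ ≡ m + d → IsFlat M F
  full-flat F F⊆E ∣F∣≡ = F⊆E , λ x x∈E x∉F → contradiction
    (subst (_≤ m + d) (trans (∣∪⁅x⁆∣ F x x∉F) (cong suc ∣F∣≡)) (∣F∣≤ (⊆-∪ F⊆E (⁅x⁆⊆ {E = E M} x∈E))))
    (ℕP.<-irrefl refl)

  medium-nonflat : ∀ F → F ⊆ E M → d ≤ ∣ F ∣ → ∣ F ∣ < m + d → ¬ IsFlat M F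
  medium-nonflat F F⊆E d≤∣F∣ ∣F∣<m+d (_ , flat) =
    ℕP.<⇒≱ (subst (∣ F ∣ <_) (sym ∣E∣≡) ∣F∣<m+d) (SubP.p⊆q⇒∣p∣≤∣q∣ E⊆F)
    where
    E⊆F : E M ⊆ F
    E⊆F {x} x∈E with x ∈? F
    ... | yes x∈F = x∈F
    ... | no x∉F = contradiction
      (subst (rk M F <_) (rk-∪⁅x⁆ F x F⊆E x∈E x∉F) (flat x x∈E x∉F))
      (ℕP.≤⇒≯ (ℕP.≤-trans (ℕP.m⊓n≤n (suc ∣ F ∣) d)
        (ℕP.≤-reflexive (sym (trans (rk≡ F F⊆E) (ℕP.m≥n⇒m⊓n≡n d≤∣F∣))))))

  -- The flats are the sets with fewer than d elements and the ground set. As G vanishes when at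
  -- most m elements remain, the sum may run over subsets of every size; the ground set, where b =
  -- 0, contributes v separately through `δ b 0`.
  sumFlats≡ : 1 ≤ m → (f : Subset (n M) → ℤ) (G : ℕ → ℕ → ℤ) (v : ℤ) →
    (∀ a b → b ≤ m → G a b ≡ Z.+ 0) →
    (∀ F → F ⊆ E M → ∣ F ∣ < d → f F ≡ G ∣ F ∣ (m + d ∸ ∣ F ∣)) →
    (∀ F → F ⊆ E M → ∣ F ∣ ≡ m + d → f F ≡ v) →
    sumFlats M f ≡ bsum (m + d) G +ℤ v
  sumFlats≡ 1≤m f G v G≡0 f-small f-full =
    trans (sum-subsets (E M) (λ F → if does (isFlat? M F) then f F else Z.+ 0)
            (λ a b → G a b +ℤ δ b 0 *ℤ v) t⊆ (λ F F⊈E → if-no (isFlat? M F) (F⊈E ∘ proj₁)))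
    (trans (cong (λ N → bsum N (λ a b → G a b +ℤ δ b 0 *ℤ v)) ∣E∣≡)
    (trans (bsum-+ (m + d) G (λ _ b → δ b 0 *ℤ v)) (cong (bsum (m + d) G +ℤ_) (bsum-δʳ (m + d) v))))
    where
    δ-pos : ∀ {b} → 1 ≤ b → δ b 0 *ℤ v ≡ Z.+ 0
    δ-pos (s≤s _) = ℤP.*-zeroˡ v

    small : ∀ F b → F ⊆ E M → ∣ F ∣ < d → m + d ∸ ∣ F ∣ ≡ b →
      (if does (isFlat? M F) then f F else Z.+ 0) ≡ G ∣ F ∣ b +ℤ δ b 0 *ℤ v
    small F _ F⊆E ∣F∣<d refl = trans (if-yes (isFlat? M F) (small-flat F F⊆E ∣F∣<d))
      (trans (f-small F F⊆E ∣F∣<d) (trans (sym (ℤP.+-identityʳ _))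
        (cong (G ∣ F ∣ (m + d ∸ ∣ F ∣) +ℤ_) (sym (δ-pos (ℕP.m<n⇒0<n∸m (ℕP.<-≤-trans ∣F∣<d (ℕP.m≤n+m d m))))))))

    medium : ∀ F b → F ⊆ E M → d ≤ ∣ F ∣ → ∣ F ∣ < m + d → m + d ∸ ∣ F ∣ ≡ b →
      (if does (isFlat? M F) then f F else Z.+ 0) ≡ G ∣ F ∣ b +ℤ δ b 0 *ℤ v
    medium F _ F⊆E d≤∣F∣ ∣F∣<m+d refl = trans (if-no (isFlat? M F) (medium-nonflat F F⊆E d≤∣F∣ ∣F∣<m+d))
      (sym (cong₂ _+ℤ_
        (G≡0 ∣ F ∣ _ (ℕP.≤-trans (ℕP.∸-monoʳ-≤ (m + d) d≤∣F∣) (ℕP.≤-reflexive (ℕP.m+n∸n≡m m d))))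
        (δ-pos (ℕP.m<n⇒0<n∸m ∣F∣<m+d))))

    full : ∀ F b → F ⊆ E M → ∣ F ∣ ≡ m + d → m + d ∸ ∣ F ∣ ≡ b →
      (if does (isFlat? M F) then f F else Z.+ 0) ≡ G ∣ F ∣ b +ℤ δ b 0 *ℤ v
    full F b F⊆E ∣F∣≡ eq with trans (sym eq) (trans (cong (m + d ∸_) ∣F∣≡) (ℕP.n∸n≡0 (m + d)))
    ... | refl = trans (if-yes (isFlat? M F) (full-flat F F⊆E ∣F∣≡)) (trans (f-full F F⊆E ∣F∣≡)
      (sym (trans (cong₂ _+ℤ_ (G≡0 ∣ F ∣ 0 z≤n) (ℤP.*-identityˡ v)) (ℤP.+-identityˡ v))))

    t⊆ : ∀ F → F ⊆ E M →
      (if does (isFlat? M F) then f F else Z.+ 0) ≡ G ∣ F ∣ (∣ E M ∣ ∸ ∣ F ∣) +ℤ δ (∣ E M ∣ ∸ ∣ F ∣) 0 *ℤ v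
    t⊆ F F⊆E with ∣ F ∣ <? d
    ... | yes ∣F∣<d = small F _ F⊆E ∣F∣<d (cong (_∸ ∣ F ∣) (sym ∣E∣≡))
    ... | no ∣F∣≮d with ∣ F ∣ <? (m + d)
    ...   | yes ∣F∣<m+d = medium F _ F⊆E (ℕP.≮⇒≥ ∣F∣≮d) ∣F∣<m+d (cong (_∸ ∣ F ∣) (sym ∣E∣≡))
    ...   | no ∣F∣≮m+d = full F _ F⊆E (ℕP.≤-antisym (∣F∣≤ F⊆E) (ℕP.≮⇒≥ ∣F∣≮m+d)) (cong (_∸ ∣ F ∣) (sym ∣E∣≡))

  -- The function c gives the corank in terms of the number b of elements of F left out. It differs
  -- for the two kinds of flats: b when F is independent, `b ∸ m` when F is the ground set.
  χ-restrict : ∀ F → F ⊆ E M → ∀ k (c : ℕ → ℕ) →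
    (∀ a b → a + b ≡ ∣ F ∣ → ∣ F ∣ ⊓ d ∸ a ⊓ d ≡ c b) →
    χ (restrict M F) k ≡ bsum ∣ F ∣ (λ a b → sign a *ℤ δ (c b) k)
  χ-restrict F F⊆E k c codim = sum-subsets F _ _ t⊆ (λ A A⊈F → if-no (A ⊆? F) A⊈F)
    where
    corank : ∀ A → A ⊆ F → rk M F ∸ rk M A ≡ c (∣ F ∣ ∸ ∣ A ∣)
    corank A A⊆F = trans (cong₂ _∸_ (rk≡ F F⊆E) (rk≡ A (F⊆E ∘ A⊆F)))
      (codim ∣ A ∣ (∣ F ∣ ∸ ∣ A ∣) (ℕP.m+[n∸m]≡n (SubP.p⊆q⇒∣p∣≤∣q∣ A⊆F)))

    if-sign : ∀ x s → (if does (x ≟ k) then s else Z.+ 0) ≡ s *ℤ δ x k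
    if-sign x s with does (x ≟ k)
    ... | true  = sym (ℤP.*-identityʳ s)
    ... | false = sym (ℤP.*-zeroʳ s)

    t⊆ : ∀ A → A ⊆ F →
      (if does (A ⊆? F) then (if does (rk M F ∸ rk M A ≟ k) then sign ∣ A ∣ else Z.+ 0) else Z.+ 0)
      ≡ sign ∣ A ∣ *ℤ δ (c (∣ F ∣ ∸ ∣ A ∣)) k
    t⊆ A A⊆F = trans (if-yes (A ⊆? F) A⊆F)
      (trans (if-sign (rk M F ∸ rk M A) (sign ∣ A ∣)) (cong (λ x → sign ∣ A ∣ *ℤ δ x k) (corank A A⊆F)))

-- Kazhdan-Lusztig and Z-polynomials of uniform matroids

bsum-signˡ : ∀ n → bsum n (λ a _ → sign a) ≡ δ n 0
bsum-signˡ zero    = refl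
bsum-signˡ (suc n) = trans (sym (bsum-+ n (λ a _ → -ℤ sign a) (λ a _ → sign a)))
  (trans (bsum-cong n (λ a _ _ → ℤP.+-inverseˡ (sign a))) (bsum-zero n))

bsum-sumℤ : ∀ n {A : Set} (t : ℕ → ℕ → A → ℤ) xs →
  bsum n (λ a b → sumℤ (map (t a b) xs)) ≡ sumℤ (map (λ x → bsum n (λ a b → t a b x)) xs)
bsum-sumℤ n t []       = bsum-zero n
bsum-sumℤ n t (x ∷ xs) = trans (bsum-+ n (λ a b → t a b x) (λ a b → sumℤ (map (t a b) xs)))
  (cong (bsum n (λ a b → t a b x) +ℤ_) (bsum-sumℤ n t xs))

⋆-cong : ∀ {f f′ g g′ : Poly} k → (∀ j → f j ≡ f′ j) → (∀ j → g j ≡ g′ j) → (f ⋆ g) k ≡ (f′ ⋆ g′) k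
⋆-cong k f≗f′ g≗g′ =
  cong sumℤ (ListP.map-cong (λ j → cong₂ _*ℤ_ (f≗f′ j) (g≗g′ (k ∸ j))) (upTo (suc k)))

⋆-zeroʳ : ∀ f {g : Poly} k → (∀ j → g j ≡ Z.+ 0) → (f ⋆ g) k ≡ Z.+ 0
⋆-zeroʳ f k g≗0 =
  sumℤ-zero _ (λ j → trans (cong (f j *ℤ_) (g≗0 (k ∸ j))) (ℤP.*-zeroʳ (f j))) (upTo (suc k))

bsum-⋆ : ∀ n (F : ℕ → ℕ → Poly) (q : Poly) k →
  bsum n (λ a b → (F a b ⋆ q) k) ≡ ((λ j → bsum n (λ a b → F a b j)) ⋆ q) k
bsum-⋆ n F q k = trans (bsum-sumℤ n (λ a b j → F a b j *ℤ q (k ∸ j)) (upTo (suc k)))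
  (cong sumℤ (ListP.map-cong (λ j → bsum-*ʳ n (λ a b → F a b j) (q (k ∸ j))) (upTo (suc k))))

shift-≤ : ∀ {s k} q → s ≤ k → shift s q k ≡ q (k ∸ s)
shift-≤ {s} {k} q = if-yes (s ≤? k)

shift-> : ∀ {s k} q → k < s → shift s q k ≡ Z.+ 0
shift-> {s} {k} q k<s = if-no (s ≤? k) (ℕP.<⇒≱ k<s)

sum-δ : ∀ s n (c : ℕ → ℤ) →
  sumℤ (applyUpTo (λ j → δ s j *ℤ c j) n) ≡ (if does (s <? n) then c s else Z.+ 0)
sum-δ s       zero    c = refl
sum-δ zero    (suc n) c = trans
  (cong₂ _+ℤ_ (ℤP.*-identityˡ (c 0))
    (trans (cong sumℤ (sym (ListP.map-upTo (λ j → Z.+ 0 *ℤ c (suc j)) n)))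
           (sumℤ-zero _ (λ j → ℤP.*-zeroˡ (c (suc j))) (upTo n))))
  (ℤP.+-identityʳ (c 0))
sum-δ (suc s) (suc n) c = trans
  (cong₂ _+ℤ_ (ℤP.*-zeroˡ (c 0)) (sum-δ s n (λ j → c (suc j)))) (ℤP.+-identityˡ _)

δ-⋆ : ∀ s (q : Poly) k → (δ s ⋆ q) k ≡ shift s q k
δ-⋆ s q k = trans (cong sumℤ (ListP.map-upTo (λ j → δ s j *ℤ q (k ∸ j)) (suc k)))
  (trans (sum-δ s (suc k) (λ j → q (k ∸ j))) (step s))
  where
  step : ∀ s → (if does (s <? suc k) then q (k ∸ s) else Z.+ 0) ≡ shift s q k
  step zero    = refl
  step (suc s) = refl

⋆-onePoly : ∀ (f : Poly) k → (f ⋆ onePoly) k ≡ f k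
⋆-onePoly f k = trans (cong sumℤ (ListP.map-upTo (λ j → f j *ℤ onePoly (k ∸ j)) (suc k))) (go f k)
  where
  go : ∀ (f : Poly) k → sumℤ (applyUpTo (λ j → f j *ℤ onePoly (k ∸ j)) (suc k)) ≡ f k
  go f zero    = trans (ℤP.+-identityʳ _) (ℤP.*-identityʳ (f 0))
  go f (suc k) = trans (cong₂ _+ℤ_ (ℤP.*-zeroʳ (f 0)) (go (λ j → f (suc j)) k)) (ℤP.+-identityˡ _)

shift-onePoly : ∀ d i → shift d onePoly i ≡ δ d i
shift-onePoly zero          zero    = refl
shift-onePoly zero          (suc i) = refl
shift-onePoly (suc d)       zero    = refl
shift-onePoly (suc zero)    (suc i) = shift-onePoly zero i
shift-onePoly (suc (suc d)) (suc i) = shift-onePoly (suc d) i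

δ-refl : ∀ d → δ d d ≡ Z.+ 1
δ-refl d = if-yes (d ≟ d) refl

δ-≢ : ∀ {x k} → ¬ (x ≡ k) → δ x k ≡ Z.+ 0
δ-≢ {x} {k} = if-no (x ≟ k)

δ-∸ : ∀ {d i} → 1 ≤ d → i ≤ d → δ d (d ∸ i) ≡ δ 0 i
δ-∸ {d} {zero}  1≤d i≤d = δ-refl d
δ-∸ {d} {suc i} 1≤d i≤d = δ-≢ (ℕP.<⇒≢ (ℕP.∸-monoʳ-< (s≤s z≤n) i≤d) ∘ sym)

-- The coefficients of (t - 1)^s, the characteristic polynomial of the Boolean matroid of rank s.
boolχ : ℕ → Poly
boolχ s k = bsum s (λ a b → sign a *ℤ δ b k)

module KL (P : Mat → Poly) (isKL : IsKL P) (m : ℕ) (1≤m : 1 ≤ m) where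

  -- For b > m this is the characteristic polynomial of the uniform matroid of rank b - m on b
  -- elements. The truncation in `b′ ∸ m` gives corank 0 to all spanning subsets at once.
  uχ : ℕ → Poly
  uχ b k = bsum b (λ a b′ → sign a *ℤ δ (b′ ∸ m) k)

  -- Indexed by the number b of elements left after a contraction, which has rank b - m. The value 0
  -- for b ≤ m is what `sumFlats≡` requires of G: these sizes are non-flats or the separately
  -- treated ground set.
  p : ℕ → Poly
  p b k = if does (m <? b) then P (U m (b ∸ m)) k else Z.+ 0

  p-≤ : ∀ {b} → b ≤ m → ∀ k → p b k ≡ Z.+ 0
  p-≤ {b} b≤m k = if-no (m <? b) (ℕP.≤⇒≯ b≤m)

  p-> : ∀ {b} → m < b → ∀ k → p b k ≡ P (U m (b ∸ m)) k
  p-> {b} m<b k = if-yes (m <? b) m<b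

  p-+ : ∀ {d} → 1 ≤ d → ∀ k → p (m + d) k ≡ P (U m d) k
  p-+ {d} 1≤d k = trans (p-> (ℕP.m<m+n m 1≤d) k) (cong (λ x → P (U m x) k) (ℕP.m+n∸m≡n m d))

  P-vanishes : ∀ {M d} → IsUniform M m d → 1 ≤ d → ∀ k → d ≤ 2 * k → P M k ≡ Z.+ 0
  P-vanishes {M} {d} u 1≤d k d≤2k =
    proj₁ (proj₂ (isKL M isMatroid (loopless (λ d≡0 → contradiction (sym d≡0) (ℕP.<⇒≢ 1≤d)))))
      (subst (0 <_) (sym rank≡) 1≤d) k (subst (_≤ 2 * k) (sym rank≡) d≤2k)
    where open Uniform u

  P-contract-full : ∀ {M d} → IsUniform M m d → ∀ F → F ⊆ E M → ∣ F ∣ ≡ m + d →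
    ∀ k → P (contract M F) k ≡ onePoly k
  P-contract-full u F F⊆E ∣F∣≡ =
    proj₁ (isKL _ isMatroid (loopless (λ _ → refl))) rank≡
    where open Uniform (Uniform.contract-full u F F⊆E ∣F∣≡)

  χ-small : ∀ {M d} → IsUniform M m d → ∀ F → F ⊆ E M → ∣ F ∣ < d →
    ∀ k → χ (restrict M F) k ≡ boolχ ∣ F ∣ k
  χ-small {M} {d} u F F⊆E ∣F∣<d k = χ-restrict F F⊆E k id codim
    where
    open Uniform u
    codim : ∀ a b → a + b ≡ ∣ F ∣ → ∣ F ∣ ⊓ d ∸ a ⊓ d ≡ b
    codim a b eq = trans
      (cong₂ _∸_ (ℕP.m≤n⇒m⊓n≡m (ℕP.<⇒≤ ∣F∣<d))
                 (ℕP.m≤n⇒m⊓n≡m (ℕP.≤-trans (ℕP.m+n≤o⇒m≤o a (ℕP.≤-reflexive eq)) (ℕP.<⇒≤ ∣F∣<d))))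
      (trans (cong (_∸ a) (sym eq)) (ℕP.m+n∸m≡n a b))

  χ-full : ∀ {M d} → IsUniform M m d → ∀ F → F ⊆ E M → ∣ F ∣ ≡ m + d →
    ∀ k → χ (restrict M F) k ≡ uχ (m + d) k
  χ-full {M} {d} u F F⊆E ∣F∣≡ k =
    trans (χ-restrict F F⊆E k (_∸ m) codim) (cong (λ N → uχ N k) ∣F∣≡)
    where
    open Uniform u
    d∸a⊓d : ∀ a → d ∸ a ⊓ d ≡ d ∸ a
    d∸a⊓d a with ℕP.≤-total a d
    ... | inj₁ a≤d = cong (d ∸_) (ℕP.m≤n⇒m⊓n≡m a≤d)
    ... | inj₂ d≤a = trans (cong (d ∸_) (ℕP.m≥n⇒m⊓n≡n d≤a))
                           (trans (ℕP.n∸n≡0 d) (sym (ℕP.m≤n⇒m∸n≡0 d≤a)))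

    codim : ∀ a b → a + b ≡ ∣ F ∣ → ∣ F ∣ ⊓ d ∸ a ⊓ d ≡ b ∸ m
    codim a b eq = begin
      ∣ F ∣ ⊓ d ∸ a ⊓ d    ≡⟨ cong (λ x → x ⊓ d ∸ a ⊓ d) ∣F∣≡ ⟩
      (m + d) ⊓ d ∸ a ⊓ d  ≡⟨ cong (_∸ a ⊓ d) (m+n⊓n≡n m d) ⟩
      d ∸ a ⊓ d            ≡⟨ d∸a⊓d a ⟩
      d ∸ a                ≡⟨ sym (ℕP.[m+n]∸[m+o]≡n∸o m d a) ⟩
      m + d ∸ (m + a)      ≡⟨ cong₂ _∸_ (sym (trans eq ∣F∣≡)) (ℕP.+-comm m a) ⟩
      a + b ∸ (a + m)      ≡⟨ ℕP.[m+n]∸[m+o]≡n∸o a b m ⟩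
      b ∸ m ∎
      where open ≡-Reasoning

  -- Agreement of the contractions is asked for at the single coefficient k. `P-unique` depends on
  -- this, since for the empty flat it is known only at the reflected coefficient.
  rev-P : ∀ {M d} → IsUniform M m d → 1 ≤ d → ∀ k →
    (∀ F → F ⊆ E M → ∣ F ∣ < d →
      (boolχ ∣ F ∣ ⋆ P (contract M F)) k ≡ (boolχ ∣ F ∣ ⋆ p (m + d ∸ ∣ F ∣)) k) →
    rev d (P M) k ≡ bsum (m + d) (λ a b → (boolχ a ⋆ p b) k) +ℤ uχ (m + d) k
  rev-P {M} {d} u 1≤d k small = trans (cong (λ r → rev r (P M) k) (sym rank≡))
    (trans (proj₂ (proj₂ (isKL M isMatroid (loopless (λ d≡0 → contradiction (sym d≡0) (ℕP.<⇒≢ 1≤d))))) k)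
    (sumFlats≡ 1≤m _ _ _
      (λ a b b≤m → ⋆-zeroʳ (boolχ a) k (p-≤ b≤m))
      (λ F F⊆E ∣F∣<d → trans
        (⋆-cong {g = P (contract M F)} k (χ-small u F F⊆E ∣F∣<d) (λ _ → refl)) (small F F⊆E ∣F∣<d))
      (λ F F⊆E ∣F∣≡ → trans (⋆-cong k (χ-full u F F⊆E ∣F∣≡) (P-contract-full u F F⊆E ∣F∣≡))
                            (⋆-onePoly (uχ (m + d)) k))))
    where open Uniform u

  p-contract : ∀ {d a} → a < d → ∀ k → p (m + d ∸ a) k ≡ P (U m (d ∸ a)) k
  p-contract {d} a<d k =
    trans (cong (λ b → p b k) (ℕP.+-∸-assoc m (ℕP.<⇒≤ a<d))) (p-+ (ℕP.m<n⇒0<n∸m a<d) k)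

  boolχ-0-⋆ : ∀ q k → (boolχ 0 ⋆ q) k ≡ q k
  boolχ-0-⋆ q k = trans (⋆-cong {g = q} k (λ j → ℤP.*-identityˡ (δ 0 j)) (λ _ → refl)) (δ-⋆ 0 q k)

  -- This replaces invariance of `P` under isomorphism. Induction on the rank does not cover the
  -- empty flat: its contraction still has rank d and need not be the same representation as M. The
  -- degree bound disposes of it.
  P-unique : ∀ d → 1 ≤ d → ∀ M → IsUniform M m d → ∀ k → P M k ≡ P (U m d) k
  P-unique = <-rec _ step
    where
    step : ∀ d → (∀ {d′} → d′ < d → 1 ≤ d′ → ∀ M → IsUniform M m d′ → ∀ k → P M k ≡ P (U m d′) k) →
      1 ≤ d → ∀ M → IsUniform M m d → ∀ k → P M k ≡ P (U m d) k
    step d IH 1≤d M u k with d ≤? 2 * k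
    ... | yes d≤2k = trans (P-vanishes u 1≤d k d≤2k) (sym (P-vanishes (U-uniform m d) 1≤d k d≤2k))
    ... | no d≰2k = trans (top M u) (sym (top (U m d) (U-uniform m d)))
      where
      -- For 2k < d the coefficient of t^k in P is the coefficient of t^(d-k) on the reversed side,
      -- and d - k lies in the range where P itself vanishes.
      k′ = d ∸ k
      k≤d : k ≤ d
      k≤d = ℕP.≤-trans (ℕP.m≤m+n k (k + 0)) (ℕP.<⇒≤ (ℕP.≰⇒> d≰2k))
      d≤2k′ : d ≤ 2 * k′
      d≤2k′ = ℕP.≤-trans (ℕP.≤-reflexive (sym (ℕP.m+n∸n≡m d d)))
        (ℕP.≤-trans (ℕP.∸-monoʳ-≤ (d + d) (ℕP.<⇒≤ (ℕP.≰⇒> d≰2k)))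
          (ℕP.≤-reflexive (trans (cong (λ x → d + x ∸ 2 * k) (sym (ℕP.+-identityʳ d))) (sym (ℕP.*-distribˡ-∸ 2 d k)))))

      -- At the reflected coefficient the term of the empty flat vanishes, so only
      -- contractions of smaller rank matter.
      small : ∀ M → IsUniform M m d → ∀ F → F ⊆ E M → ∣ F ∣ < d → ∀ a → ∣ F ∣ ≡ a →
        (boolχ a ⋆ P (contract M F)) k′ ≡ (boolχ a ⋆ p (m + d ∸ a)) k′
      small M u F F⊆E ∣F∣<d zero eq = trans (boolχ-0-⋆ (P (contract M F)) k′)
        (trans (P-vanishes (subst (λ x → IsUniform (contract M F) m (d ∸ x)) eq (Uniform.contract-uniform u F F⊆E ∣F∣<d)) 1≤d k′ d≤2k′)
        (sym (trans (boolχ-0-⋆ (p (m + d)) k′) (trans (p-+ 1≤d k′) (P-vanishes (U-uniform m d) 1≤d k′ d≤2k′)))))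
      small M u F F⊆E ∣F∣<d (suc a) eq = ⋆-cong {f = boolχ (suc a)} k′ (λ _ → refl) (λ j → trans
        (IH (ℕP.∸-monoʳ-< (s≤s z≤n) (ℕP.<⇒≤ a<d)) (ℕP.m<n⇒0<n∸m a<d) (contract M F)
          (subst (λ x → IsUniform (contract M F) m (d ∸ x)) eq (Uniform.contract-uniform u F F⊆E ∣F∣<d)) j)
        (sym (p-contract a<d j)))
        where
        a<d : suc a < d
        a<d = subst (_< d) eq ∣F∣<d

      top : ∀ M → IsUniform M m d →
        P M k ≡ bsum (m + d) (λ a b → (boolχ a ⋆ p b) k′) +ℤ uχ (m + d) k′
      top M u = trans (cong (P M) (sym (ℕP.m∸[m∸n]≡n k≤d)))
        (trans (sym (if-yes (k′ ≤? d) (ℕP.m∸n≤m d k)))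
               (rev-P u 1≤d k′ (λ F F⊆E ∣F∣<d → small M u F F⊆E ∣F∣<d ∣ F ∣ refl)))

  P-contract : ∀ {d} F → ∣ F ∣ < d → ∀ k → P (contract (U m d) F) k ≡ p (m + d ∸ ∣ F ∣) k
  P-contract {d} F ∣F∣<d k = trans
    (P-unique (d ∸ ∣ F ∣) (ℕP.m<n⇒0<n∸m ∣F∣<d) (contract (U m d) F)
      (Uniform.contract-uniform (U-uniform m d) F SubP.⊆⊤ ∣F∣<d) k)
    (sym (p-contract ∣F∣<d k))

  rev-p : ∀ {b} → m < b → ∀ k → rev (b ∸ m) (p b) k ≡ bsum b (λ a b′ → (boolχ a ⋆ p b′) k) +ℤ uχ b k
  rev-p {b} m<b k = trans rev-cong (trans
    (rev-P (U-uniform m (b ∸ m)) (ℕP.m<n⇒0<n∸m m<b) k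
      (λ F _ ∣F∣<d → ⋆-cong {f = boolχ ∣ F ∣} k (λ _ → refl) (P-contract F ∣F∣<d)))
    (cong (λ x → bsum x (λ a b′ → (boolχ a ⋆ p b′) k) +ℤ uχ x k) (ℕP.m+[n∸m]≡n (ℕP.<⇒≤ m<b))))
    where
    rev-cong : rev (b ∸ m) (p b) k ≡ rev (b ∸ m) (P (U m (b ∸ m))) k
    rev-cong = cong (λ x → if does (k ≤? b ∸ m) then x else Z.+ 0) (p-> m<b (b ∸ m ∸ k))

  Z≡ : ∀ {d} → 1 ≤ d → ∀ k → Z P (U m d) k ≡ bsum (m + d) (λ a b → shift a (p b) k) +ℤ δ d k
  Z≡ {d} 1≤d k = sumFlats≡ 1≤m _ _ _
    (λ a b b≤m → shift-zero a (p-≤ b≤m))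
    (λ F _ ∣F∣<d → trans (cong (λ r → shift r (P (contract (U m d) F)) k) (ℕP.m≤n⇒m⊓n≡m (ℕP.<⇒≤ ∣F∣<d)))
                         (shift-cong ∣ F ∣ (P-contract F ∣F∣<d)))
    (λ F F⊆E ∣F∣≡ → trans
      (cong (λ r → shift r (P (contract (U m d) F)) k) (trans (cong (_⊓ d) ∣F∣≡) (m+n⊓n≡n m d)))
      (trans (shift-cong d (P-contract-full (U-uniform m d) F F⊆E ∣F∣≡)) (shift-onePoly d k)))
    where
    open Uniform (U-uniform m d)
    shift-cong : ∀ s {q q′ : Poly} → (∀ j → q j ≡ q′ j) → shift s q k ≡ shift s q′ k
    shift-cong s q≗q′ = cong (λ x → if does (s ≤? k) then x else Z.+ 0) (q≗q′ (k ∸ s))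

    shift-zero : ∀ s {q : Poly} → (∀ j → q j ≡ Z.+ 0) → shift s q k ≡ Z.+ 0
    shift-zero s q≗0 with does (s ≤? k)
    ... | true  = q≗0 (k ∸ s)
    ... | false = refl

  -- Sums over pairs F ⊆ G are reordered with G first. For fixed G of size s, summing (t-1)^a over
  -- the subsets of G gives t^s, by binomial inversion in each coefficient.
  bsum-boolχ-⋆ : ∀ N k → bsum N (λ _ b → bsum b (λ a b′ → (boolχ a ⋆ p b′) k)) ≡ bsum N (λ s b → shift s (p b) k)
  bsum-boolχ-⋆ N k = trans (bsum-assoc N (λ _ a b → (boolχ a ⋆ p b) k))
    (bsum-cong N (λ s b _ → trans (bsum-⋆ s (λ _ a → boolχ a) (p b) k)
      (trans (⋆-cong {g = p b} k (λ j → bsum-inversion s (λ x → δ x j)) (λ _ → refl)) (δ-⋆ s (p b) k))))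

  -- All exponents truncate to 0, so only the alternating sum over subsets of a b-element set
  -- remains.
  uχ-≤ : ∀ {b} → b ≤ m → ∀ k → uχ b k ≡ δ b 0 *ℤ δ 0 k
  uχ-≤ {b} b≤m k = trans
    (bsum-cong b (λ a b′ eq → cong (λ x → sign a *ℤ δ x k)
      (ℕP.m≤n⇒m∸n≡0 (ℕP.≤-trans (ℕP.m+n≤o⇒n≤o a (ℕP.≤-reflexive eq)) b≤m))))
    (trans (bsum-*ʳ b (λ a _ → sign a) (δ 0 k)) (cong (_*ℤ δ 0 k) (bsum-signˡ b)))

  shift≡rev : ∀ {d i} q a c → a + c ≡ d → i ≤ d → shift a q (d ∸ i) ≡ rev c q i
  shift≡rev {_} {i} q a c refl i≤a+c with i ≤? c
  ... | yes i≤c = trans (shift-≤ {a} q (subst (a ≤_) (sym eq) (ℕP.m≤m+n a (c ∸ i))))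
                    (trans (cong q (trans (cong (_∸ a) eq) (ℕP.m+n∸m≡n a (c ∸ i)))) (sym (if-yes (i ≤? c) i≤c)))
    where
    eq : a + c ∸ i ≡ a + (c ∸ i)
    eq = ℕP.+-∸-assoc a i≤c
  ... | no i≰c = trans (shift-> {a} q (ℕP.+-cancelʳ-< i _ _
                   (subst (_< a + i) (sym (ℕP.m∸n+n≡m i≤a+c)) (ℕP.+-monoʳ-< a (ℕP.≰⇒> i≰c)))))
                   (sym (if-no (i ≤? c) i≰c))

  -- The contribution of one subset of size a to t^d Z(1/t). For b > m it is the recursion for the
  -- contraction, which has rank b - m; for b ≤ m both sides vanish except at b = 0, where the
  -- ground set contributes 1.
  reflected-term : ∀ {d i} → i ≤ d → ∀ a b → a + b ≡ m + d →
    shift a (p b) (d ∸ i) +ℤ δ b 0 *ℤ δ 0 i ≡ bsum b (λ a′ b′ → (boolχ a′ ⋆ p b′) i) +ℤ uχ b i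
  reflected-term {d} {i} i≤d a b a+b≡ with m <? b
  ... | yes m<b = trans (cong₂ _+ℤ_
                    (shift≡rev (p b) a (b ∸ m) a+[b∸m]≡d i≤d)
                    (trans (cong (_*ℤ δ 0 i) (δ-≢ (λ b≡0 → contradiction (subst (m <_) b≡0 m<b) λ ()))) (ℤP.*-zeroˡ (δ 0 i))))
                  (trans (ℤP.+-identityʳ _) (rev-p m<b i))
    where
    a+[b∸m]≡d : a + (b ∸ m) ≡ d
    a+[b∸m]≡d = trans (sym (ℕP.+-∸-assoc a (ℕP.<⇒≤ m<b))) (trans (cong (_∸ m) a+b≡) (ℕP.m+n∸m≡n m d))
  ... | no m≮b = cong₂ _+ℤ_
      (trans (shift-zero (d ∸ i))
        (sym (trans (bsum-cong b (λ a′ b′ eq → ⋆-zeroʳ (boolχ a′) i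
                (p-≤ (ℕP.≤-trans (ℕP.m+n≤o⇒n≤o a′ (ℕP.≤-reflexive eq)) b≤m)))) (bsum-zero b))))
      (sym (uχ-≤ b≤m i))
    where
    b≤m : b ≤ m
    b≤m = ℕP.≮⇒≥ m≮b
    shift-zero : ∀ k → shift a (p b) k ≡ Z.+ 0
    shift-zero k with does (a ≤? k)
    ... | true  = p-≤ b≤m (k ∸ a)
    ... | false = refl

  Z-palindromic : ∀ {d i} → 1 ≤ d → i ≤ d → Z P (U m d) (d ∸ i) ≡ Z P (U m d) i
  Z-palindromic {d} {i} 1≤d i≤d = begin
    Z P (U m d) (d ∸ i)
      ≡⟨ Z≡ 1≤d (d ∸ i) ⟩
    bsum N (λ a b → shift a (p b) (d ∸ i)) +ℤ δ d (d ∸ i)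
      -- The term of the ground set is spread over all subsets, concentrated at b = 0, so that
      -- `reflected-term` applies to each subset.
      ≡⟨ cong (bsum N (λ a b → shift a (p b) (d ∸ i)) +ℤ_) (trans (δ-∸ 1≤d i≤d) (sym (bsum-δʳ N (δ 0 i)))) ⟩
    bsum N (λ a b → shift a (p b) (d ∸ i)) +ℤ bsum N (λ _ b → δ b 0 *ℤ δ 0 i)
      ≡⟨ sym (bsum-+ N (λ a b → shift a (p b) (d ∸ i)) (λ _ b → δ b 0 *ℤ δ 0 i)) ⟩
    bsum N (λ a b → shift a (p b) (d ∸ i) +ℤ δ b 0 *ℤ δ 0 i)
      ≡⟨ bsum-cong N (reflected-term i≤d) ⟩
    bsum N (λ _ b → bsum b (λ a b′ → (boolχ a ⋆ p b′) i) +ℤ uχ b i)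
      ≡⟨ bsum-+ N (λ _ b → bsum b (λ a b′ → (boolχ a ⋆ p b′) i)) (λ _ b → uχ b i) ⟩
    bsum N (λ _ b → bsum b (λ a b′ → (boolχ a ⋆ p b′) i)) +ℤ bsum N (λ _ b → uχ b i)
      ≡⟨ cong₂ _+ℤ_ (bsum-boolχ-⋆ N i)
           (trans (bsum-inversion N (λ b → δ (b ∸ m) i)) (cong (λ x → δ x i) (ℕP.m+n∸m≡n m d))) ⟩
    bsum N (λ a b → shift a (p b) i) +ℤ δ d i
      ≡⟨ sym (Z≡ 1≤d i) ⟩
    Z P (U m d) i ∎
    where
    open ≡-Reasoning
    N = m + d

  -- Entry b is the coefficient of t^(d-e) in P, for rank d = b - m.
  diag : ℕ → ℕ → ℤ
  diag e b = if does (m + e ≤? b) then p b (b ∸ (m + e)) else Z.+ 0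

  diag-< : ∀ e {b} → b < m + e → diag e b ≡ Z.+ 0
  diag-< e {b} b<m+e = if-no (m + e ≤? b) (ℕP.<⇒≱ b<m+e)

  -- For b ≥ m + 2e the exponent b - m - e is at least half the rank b - m. Together with `diag-<`
  -- this leaves the e values m + e ≤ b < m + 2e.
  diag-≥ : ∀ e {b} → m + e + e ≤ b → diag e b ≡ Z.+ 0
  diag-≥ e {b} m+2e≤b = trans (if-yes (m + e ≤? b) (ℕP.m+n≤o⇒m≤o (m + e) m+2e≤b)) (vanish (m <? b))
    where
    vanish : Dec (m < b) → p b (b ∸ (m + e)) ≡ Z.+ 0
    vanish (no m≮b) = p-≤ (ℕP.≮⇒≥ m≮b) _
    vanish (yes m<b) = trans (p-> m<b _) (P-vanishes (U-uniform m (b ∸ m)) (ℕP.m<n⇒0<n∸m m<b) _ b∸m≤)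
      where
      j = b ∸ (m + e)
      e≤j : e ≤ j
      e≤j = ℕP.m+n≤o⇒m≤o∸n e (subst (_≤ b) (ℕP.+-comm (m + e) e) m+2e≤b)
      b∸m≤ : b ∸ m ≤ 2 * j
      b∸m≤ = ℕP.≤-trans (ℕP.m≤n+m∸n (b ∸ m) e)
        (ℕP.+-mono-≤ e≤j (ℕP.≤-reflexive (trans (ℕP.∸-+-assoc b m e) (sym (ℕP.+-identityʳ j)))))

  -- The exponent i - a equals (b - m) - e because a + b = m + e + i. So along a row of fixed e the
  -- summand depends on b alone, and i enters only through the number of subsets.
  shift≡diag : ∀ e i a b → a + b ≡ m + (e + i) → shift a (p b) i ≡ diag e b
  shift≡diag e i a b eq with a ≤? i
  ... | yes a≤i = trans (shift-≤ {a} (p b) a≤i) (trans (cong (p b) i∸a≡)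
                    (sym (if-yes (m + e ≤? b) (subst (m + e ≤_) (sym b≡) (ℕP.m≤m+n (m + e) (i ∸ a))))))
    where
    b≡ : b ≡ m + e + (i ∸ a)
    b≡ = trans (sym (ℕP.m+n∸m≡n a b)) (trans (cong (_∸ a) (trans eq (sym (ℕP.+-assoc m e i))))
           (ℕP.+-∸-assoc (m + e) a≤i))
    i∸a≡ : i ∸ a ≡ b ∸ (m + e)
    i∸a≡ = sym (trans (cong (_∸ (m + e)) b≡) (ℕP.m+n∸m≡n (m + e) (i ∸ a)))
  ... | no a≰i = trans (shift-> {a} (p b) (ℕP.≰⇒> a≰i)) (sym (diag-< e (ℕP.+-cancelˡ-< i b (m + e)
                   (ℕP.<-≤-trans (ℕP.+-monoˡ-< b (ℕP.≰⇒> a≰i)) (ℕP.≤-reflexive (trans eq (trans (sym (ℕP.+-assoc m e i)) (ℕP.+-comm (m + e) i))))))))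

  Z≡diag : ∀ {e} i → 1 ≤ e → Z P (U m (e + i)) i ≡ bsum (m + (e + i)) (λ _ b → diag e b)
  Z≡diag {e} i 1≤e = trans (Z≡ (ℕP.≤-trans 1≤e (ℕP.m≤m+n e i)) i)
    (trans (cong₂ _+ℤ_ (bsum-cong (m + (e + i)) (shift≡diag e i)) (δ-≢ (ℕP.<⇒≢ (ℕP.m<n+m i 1≤e) ∘ sym)))
           (ℤP.+-identityʳ _))

  -- By the degree bound no proper flat reaches the exponent of the rank; only the ground set does.
  Z-top : ∀ {i} → 1 ≤ i → Z P (U m i) i ≡ Z.+ 1
  Z-top {i} 1≤i = trans (Z≡ 1≤i i) (cong₂ _+ℤ_
    (trans (bsum-cong (m + i) (λ a b eq → trans (shift≡diag 0 i a b eq) (diag-0 b))) (bsum-zero (m + i)))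
    (δ-refl i))
    where
    diag-0 : ∀ b → diag 0 b ≡ Z.+ 0
    diag-0 b with b <? m + 0
    ... | yes b<m = diag-< 0 b<m
    ... | no b≮m = diag-≥ 0 (subst (_≤ b) (sym (ℕP.+-identityʳ (m + 0))) (ℕP.≮⇒≥ b≮m))

-- Rational arithmetic and finite differences

-- Only the equations of this block are available afterwards, so the embedding of the integers never
-- unfolds into normalised fractions.
opaque
  ι : ℤ → ℚ
  ι = ℤtoℚ

  ι≡ : ∀ x → ℤtoℚ x ≡ ι x
  ι≡ x = refl

  toℚᵘ-ι : ∀ x → toℚᵘ (ι x) ℚᵘ.≃ mkℚᵘ x 0
  toℚᵘ-ι x = ℚP.toℚᵘ-fromℚᵘ (mkℚᵘ x 0)

  ι-0 : ι (Z.+ 0) ≡ 0ℚ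
  ι-0 = refl

  ι-1 : ι (Z.+ 1) ≡ 1ℚ
  ι-1 = refl

ι-+ : ∀ x y → ι (x +ℤ y) ≡ ι x +ℚ ι y
ι-+ x y = ℚP.toℚᵘ-injective (ℚᵘP.≃-trans (toℚᵘ-ι (x +ℤ y)) (ℚᵘP.≃-sym
  (ℚᵘP.≃-trans (ℚP.toℚᵘ-homo-+ (ι x) (ι y))
  (ℚᵘP.≃-trans (ℚᵘP.+-cong (toℚᵘ-ι x) (toℚᵘ-ι y))
    (*≡* (cong (_*ℤ Z.+ 1) (cong₂ _+ℤ_ (ℤP.*-identityʳ x) (ℤP.*-identityʳ y))))))))

ι-* : ∀ x y → ι (x *ℤ y) ≡ ι x *ℚ ι y
ι-* x y = ℚP.toℚᵘ-injective (ℚᵘP.≃-trans (toℚᵘ-ι (x *ℤ y)) (ℚᵘP.≃-sym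
  (ℚᵘP.≃-trans (ℚP.toℚᵘ-homo-* (ι x) (ι y))
  (ℚᵘP.≃-trans (ℚᵘP.*-cong (toℚᵘ-ι x) (toℚᵘ-ι y)) (*≡* refl)))))

ι-neg : ∀ x → ι (-ℤ x) ≡ -ℚ ι x
ι-neg x = ℚP.toℚᵘ-injective (ℚᵘP.≃-trans (toℚᵘ-ι (-ℤ x)) (ℚᵘP.≃-sym
  (ℚᵘP.≃-trans (ℚP.toℚᵘ-homo‿- (ι x))
  (ℚᵘP.≃-trans (ℚᵘP.-‿cong (toℚᵘ-ι x)) (*≡* refl)))))

ν : ℕ → ℚ
ν n = ι (Z.+ n)

ν-+ : ∀ a b → ν (a + b) ≡ ν a +ℚ ν b
ν-+ a b = ι-+ (Z.+ a) (Z.+ b)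

ν-* : ∀ a b → ν (a * b) ≡ ν a *ℚ ν b
ν-* a b = trans (cong ι (ℤP.pos-* a b)) (ι-* (Z.+ a) (Z.+ b))

ν-suc : ∀ n → ν (suc n) ≡ 1ℚ +ℚ ν n
ν-suc n = trans (ν-+ 1 n) (cong (_+ℚ ν n) ι-1)

opaque
  inv : ℕ → ℚ
  inv n = 1ℚ ÷ℕ n

  -- At n = 0 both sides are 0, since `inv 0` inherits the convention of `÷ℕ`.
  ÷ℕ≡*inv : ∀ p n → p ÷ℕ n ≡ p *ℚ inv n
  ÷ℕ≡*inv p zero    = sym (ℚP.*-zeroʳ p)
  ÷ℕ≡*inv p (suc n) = cong (p *ℚ_) (sym (ℚP.*-identityˡ (Z.+ 1 Q./ suc n)))

  ν*inv : ∀ n .{{_ : NonZero n}} → ν n *ℚ inv n ≡ 1ℚ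
  ν*inv (suc n) = trans (cong (ν (suc n) *ℚ_) (ℚP.*-identityˡ (Z.+ 1 Q./ suc n)))
    (ℚP.toℚᵘ-injective (ℚᵘP.≃-trans (ℚP.toℚᵘ-homo-* (ν (suc n)) (Z.+ 1 Q./ suc n))
    (ℚᵘP.≃-trans (ℚᵘP.*-cong (toℚᵘ-ι (Z.+ suc n)) (ℚP.toℚᵘ-fromℚᵘ (mkℚᵘ (Z.+ 1) n)))
      (*≡* (trans (ℤP.*-identityʳ _) (trans (ℤP.*-identityʳ _)
        (sym (trans (ℤP.*-identityˡ _) (ℤP.*-identityˡ (Z.+ suc n))))))))))

fact invFact : ℕ → ℚ
fact n = ν (n !)
invFact n = inv (n !)

fact*invFact : ∀ n → fact n *ℚ invFact n ≡ 1ℚ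
fact*invFact n = ν*inv (n !) {{n ℕP.!≢0}}

fact-suc : ∀ n → fact (suc n) ≡ ν (suc n) *ℚ fact n
fact-suc n = ν-* (suc n) (n !)

Sum : ℕ → (ℕ → ℚ) → ℚ
Sum zero    F = 0ℚ
Sum (suc n) F = Sum n F +ℚ F n

Sum-cong : ∀ n {F G : ℕ → ℚ} → (∀ j → j < n → F j ≡ G j) → Sum n F ≡ Sum n G
Sum-cong zero    F≗G = refl
Sum-cong (suc n) F≗G = cong₂ _+ℚ_ (Sum-cong n (λ j j<n → F≗G j (ℕP.m≤n⇒m≤1+n j<n))) (F≗G n ℕP.≤-refl)

Sum-zero : ∀ n {F : ℕ → ℚ} → (∀ j → j < n → F j ≡ 0ℚ) → Sum n F ≡ 0ℚ
Sum-zero zero    F≗0 = refl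
Sum-zero (suc n) F≗0 = cong₂ _+ℚ_ (Sum-zero n (λ j j<n → F≗0 j (ℕP.m≤n⇒m≤1+n j<n))) (F≗0 n ℕP.≤-refl)

+ℚ-interchange : ∀ a b c d → (a +ℚ b) +ℚ (c +ℚ d) ≡ (a +ℚ c) +ℚ (b +ℚ d)
+ℚ-interchange = solve 4 (λ a b c d → (a :+ b) :+ (c :+ d) := (a :+ c) :+ (b :+ d)) refl
  where open ℚSolver

Sum-+ : ∀ n (F G : ℕ → ℚ) → Sum n (λ j → F j +ℚ G j) ≡ Sum n F +ℚ Sum n G
Sum-+ zero    F G = refl
Sum-+ (suc n) F G = trans (cong (_+ℚ (F n +ℚ G n)) (Sum-+ n F G)) (+ℚ-interchange (Sum n F) (Sum n G) (F n) (G n))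

Sum-*ˡ : ∀ n c (F : ℕ → ℚ) → Sum n (λ j → c *ℚ F j) ≡ c *ℚ Sum n F
Sum-*ˡ zero    c F = sym (ℚP.*-zeroʳ c)
Sum-*ˡ (suc n) c F = trans (cong (_+ℚ c *ℚ F n) (Sum-*ˡ n c F)) (sym (ℚP.*-distribˡ-+ c (Sum n F) (F n)))

Sum-head : ∀ n (F : ℕ → ℚ) → Sum (suc n) F ≡ F 0 +ℚ Sum n (λ j → F (suc j))
Sum-head zero    F = ℚP.+-comm 0ℚ (F 0)
Sum-head (suc n) F = trans (cong (_+ℚ F (suc n)) (Sum-head n F))
  (ℚP.+-assoc (F 0) (Sum n (λ j → F (suc j))) (F (suc n)))

Sum-split : ∀ a n (F : ℕ → ℚ) → Sum (a + n) F ≡ Sum a F +ℚ Sum n (λ j → F (a + j))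
Sum-split a zero    F = trans (cong (λ x → Sum x F) (ℕP.+-identityʳ a)) (sym (ℚP.+-identityʳ (Sum a F)))
Sum-split a (suc n) F = trans (cong (λ x → Sum x F) (ℕP.+-suc a n))
  (trans (cong (_+ℚ F (a + n)) (Sum-split a n F))
         (ℚP.+-assoc (Sum a F) (Sum n (λ j → F (a + j))) (F (a + n))))

sumℚ≡Sum : ∀ n (F : ℕ → ℚ) → sumℚ (map F (upTo n)) ≡ Sum n F
sumℚ≡Sum n F = trans (cong sumℚ (ListP.map-upTo F n)) (go n F)
  where
  go : ∀ n (F : ℕ → ℚ) → sumℚ (applyUpTo F n) ≡ Sum n F
  go zero    F = refl
  go (suc n) F = trans (cong (F 0 +ℚ_) (go n (λ j → F (suc j)))) (sym (Sum-head n F))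

-- multichoose i h = (i - 1 + h choose h), with value 1 at i = h = 0.
multichoose : ℕ → ℕ → ℕ
multichoose i       zero    = 1
multichoose zero    (suc h) = 0
multichoose (suc i) (suc h) = multichoose i (suc h) + multichoose (suc i) h

multichoose-1 : ∀ h → multichoose 1 h ≡ 1
multichoose-1 zero    = refl
multichoose-1 (suc h) = multichoose-1 h

nC0≡1 : ∀ n → n C 0 ≡ 1
nC0≡1 n = trans (nCk≡nC[n∸k] {0} {n} z≤n) (nCn≡1 n)

multichoose≡C : ∀ i h → multichoose (suc i) h ≡ (i + h) C h
multichoose≡C i       zero    = sym (nC0≡1 (i + 0))
multichoose≡C zero    (suc h) = trans (multichoose-1 h) (sym (nCn≡1 (suc h)))
multichoose≡C (suc i) (suc h) = begin
  multichoose (suc i) (suc h) + multichoose (suc (suc i)) h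
    ≡⟨ cong₂ _+_ (multichoose≡C i (suc h)) (multichoose≡C (suc i) h) ⟩
  (i + suc h) C suc h + (suc i + h) C h
    ≡⟨ cong (λ x → x C suc h + (suc i + h) C h) (ℕP.+-suc i h) ⟩
  (suc i + h) C suc h + (suc i + h) C h
    ≡⟨ ℕP.+-comm ((suc i + h) C suc h) _ ⟩
  (suc i + h) C h + (suc i + h) C suc h
    ≡⟨ nCk+nC[k+1]≡[n+1]C[k+1] (suc i + h) h ⟩
  suc (suc i + h) C suc h
    ≡⟨ cong (λ x → suc x C suc h) (sym (ℕP.+-suc i h)) ⟩
  suc (i + suc h) C suc h ∎
  where open ≡-Reasoning

-- The ratio of consecutive terms. It is what turns the weights of the stated sum into differences
-- in h (`weight≡`).
multichoose-suc : ∀ i h → suc h * multichoose i (suc h) ≡ (i + h) * multichoose i h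
multichoose-suc zero    zero    = refl
multichoose-suc zero    (suc h) = trans (ℕP.*-zeroʳ h) (sym (ℕP.*-zeroʳ h))
multichoose-suc (suc i) zero    = trans
  (solve 1 (λ x → con 1 :* (x :+ con 1) := con 1 :+ con 1 :* x) refl (multichoose i 1))
  (trans (cong suc (multichoose-suc i 0)) (sym (solve 1 (λ x → (con 1 :+ (x :+ con 0)) :* con 1 := con 1 :+ (x :+ con 0) :* con 1) refl i)))
  where open ℕSolver
multichoose-suc (suc i) (suc h) = begin
  suc (suc h) * (x + y)
    ≡⟨ solve 3 (λ h x y → (con 2 :+ h) :* (x :+ y) := (con 2 :+ h) :* x :+ ((con 1 :+ h) :* y :+ y)) refl h x y ⟩
  suc (suc h) * x + (suc h * y + y)
    ≡⟨ cong₂ (λ s t → s + (t + y)) (multichoose-suc i (suc h)) (multichoose-suc (suc i) h) ⟩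
  (i + suc h) * v + ((suc i + h) * w + (v + w))
    ≡⟨ solve 4 (λ i h v w → (i :+ (con 1 :+ h)) :* v :+ ((con 1 :+ i :+ h) :* w :+ (v :+ w))
                          := (con 1 :+ i :+ (con 1 :+ h)) :* (v :+ w)) refl i h v w ⟩
  (suc i + suc h) * (v + w) ∎
  where
  open ≡-Reasoning
  open ℕSolver
  x = multichoose i (suc (suc h))
  y = multichoose (suc i) (suc h)
  v = multichoose i (suc h)
  w = multichoose (suc i) h

multichoose-factorial : ∀ a b → multichoose (suc a) b * (b ! * a !) ≡ (a + b) !
multichoose-factorial a zero    = trans (ℕP.*-identityˡ _) (trans (ℕP.*-identityˡ (a !)) (cong _! (sym (ℕP.+-identityʳ a))))
multichoose-factorial a (suc b) = begin
  x * (suc b * b ! * a !)          ≡⟨ solve 4 (λ x s t r → x :* (s :* t :* r) := s :* x :* (t :* r)) refl x (suc b) (b !) (a !) ⟩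
  suc b * x * (b ! * a !)          ≡⟨ cong (_* (b ! * a !)) (multichoose-suc (suc a) b) ⟩
  (suc a + b) * y * (b ! * a !)    ≡⟨ ℕP.*-assoc (suc a + b) y _ ⟩
  (suc a + b) * (y * (b ! * a !))  ≡⟨ cong ((suc a + b) *_) (multichoose-factorial a b) ⟩
  (suc (a + b)) !                  ≡⟨ cong _! (sym (ℕP.+-suc a b)) ⟩
  (a + suc b) ! ∎
  where
  open ≡-Reasoning
  open ℕSolver
  x = multichoose (suc a) (suc b)
  y = multichoose (suc a) b

ν-C : ∀ a b → ν ((a + b) C a) ≡ fact (a + b) *ℚ (invFact a *ℚ invFact b)
ν-C a b = begin
  c                              ≡⟨ solve 1 (λ c → c := c :* (con 1ℚ :* con 1ℚ)) refl c ⟩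
  c *ℚ (1ℚ *ℚ 1ℚ)                ≡⟨ cong₂ (λ s t → c *ℚ (s *ℚ t)) (sym (fact*invFact a)) (sym (fact*invFact b)) ⟩
  c *ℚ ((fa *ℚ ga) *ℚ (fb *ℚ gb)) ≡⟨ solve 5 (λ c fa ga fb gb → c :* ((fa :* ga) :* (fb :* gb)) := (c :* (fa :* fb)) :* (ga :* gb)) refl c fa ga fb gb ⟩
  (c *ℚ (fa *ℚ fb)) *ℚ (ga *ℚ gb) ≡⟨ cong (_*ℚ (ga *ℚ gb)) c*≡ ⟩
  fact (a + b) *ℚ (ga *ℚ gb) ∎
  where
  open ≡-Reasoning
  open ℚSolver
  c = ν ((a + b) C a)
  fa = fact a
  fb = fact b
  ga = invFact a
  gb = invFact b
  c*≡ : c *ℚ (fa *ℚ fb) ≡ fact (a + b)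
  c*≡ = trans (cong (c *ℚ_) (sym (ν-* (a !) (b !)))) (trans (sym (ν-* _ (a ! * b !)))
    (cong ν (trans (cong (λ x → (x C a) * (a ! * b !)) (ℕP.+-comm a b))
      (trans (cong (_* (a ! * b !)) (sym (multichoose≡C b a))) (trans (multichoose-factorial b a) (cong _! (ℕP.+-comm b a)))))))

-- By finite differences: F agrees with a polynomial of degree less than k.
DegLess : ℕ → (ℕ → ℚ) → Set
DegLess zero    F = ∀ n → F n ≡ 0ℚ
DegLess (suc k) F = DegLess k (λ n → F (suc n) -ℚ F n)

DegLess-cong : ∀ k {F G : ℕ → ℚ} → (∀ n → F n ≡ G n) → DegLess k F → DegLess k G
DegLess-cong zero    F≗G dF n = trans (sym (F≗G n)) (dF n)
DegLess-cong (suc k) F≗G dF = DegLess-cong k (λ n → cong₂ _-ℚ_ (F≗G (suc n)) (F≗G n)) dF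

DegLess-zero : ∀ k {F : ℕ → ℚ} → (∀ n → F n ≡ 0ℚ) → DegLess k F
DegLess-zero zero    F≗0 = F≗0
DegLess-zero (suc k) F≗0 = DegLess-zero k (λ n → cong₂ _-ℚ_ (F≗0 (suc n)) (F≗0 n))

DegLess-+ : ∀ k {F G : ℕ → ℚ} → DegLess k F → DegLess k G → DegLess k (λ n → F n +ℚ G n)
DegLess-+ zero    dF dG n = cong₂ _+ℚ_ (dF n) (dG n)
DegLess-+ (suc k) {F} {G} dF dG = DegLess-cong k
  (λ n → solve 4 (λ a b c d → (a :- b) :+ (c :- d) := (a :+ c) :- (b :+ d)) refl (F (suc n)) (F n) (G (suc n)) (G n))
  (DegLess-+ k dF dG)
  where open ℚSolver

DegLess-*ˡ : ∀ k c {F : ℕ → ℚ} → DegLess k F → DegLess k (λ n → c *ℚ F n)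
DegLess-*ˡ zero    c dF n = trans (cong (c *ℚ_) (dF n)) (ℚP.*-zeroʳ c)
DegLess-*ˡ (suc k) c {F} dF = DegLess-cong k
  (λ n → solve 3 (λ c a b → c :* (a :- b) := c :* a :- c :* b) refl c (F (suc n)) (F n))
  (DegLess-*ˡ k c dF)
  where open ℚSolver

DegLess-∘suc : ∀ k {F : ℕ → ℚ} → DegLess k F → DegLess k (λ n → F (suc n))
DegLess-∘suc zero    dF n = dF (suc n)
DegLess-∘suc (suc k) dF = DegLess-∘suc k dF

DegLess-≤ : ∀ {k l} {F : ℕ → ℚ} → k ≤ l → DegLess k F → DegLess l F
DegLess-≤ {l = l} z≤n   dF = DegLess-zero l dF
DegLess-≤ (s≤s k≤l) dF = DegLess-≤ k≤l dF

-- Leibniz rule for differences: the linear factor has difference 1, so the difference of the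
-- product is the factor times the difference of F, plus the shifted F.
DegLess-linear : ∀ k s {F : ℕ → ℚ} → DegLess k F → DegLess (suc k) (λ n → ν (n + s) *ℚ F n)
DegLess-linear zero    s dF = DegLess-zero 1 (λ n → trans (cong (ν (n + s) *ℚ_) (dF n)) (ℚP.*-zeroʳ (ν (n + s))))
DegLess-linear (suc k) s {F} dF = DegLess-cong (suc k)
  (λ n → trans (solve 3 (λ v a b → v :* (a :- b) :+ a := (con 1ℚ :+ v) :* a :- v :* b) refl (ν (n + s)) (F (suc n)) (F n))
               (cong (λ x → x *ℚ F (suc n) -ℚ ν (n + s) *ℚ F n) (sym (ν-suc (n + s)))))
  (DegLess-+ (suc k) {λ n → ν (n + s) *ℚ (F (suc n) -ℚ F n)} {λ n → F (suc n)}
    (DegLess-linear k s dF) (DegLess-∘suc (suc k) {F} dF))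
  where open ℚSolver

DegLess-Sum : ∀ k n (F : ℕ → ℕ → ℚ) → (∀ j → j < n → DegLess k (F j)) → DegLess k (λ i → Sum n (λ j → F j i))
DegLess-Sum k zero    F dF = DegLess-zero k (λ _ → refl)
DegLess-Sum k (suc n) F dF = DegLess-+ k (DegLess-Sum k n F (λ j j<n → dF j (ℕP.m≤n⇒m≤1+n j<n))) (dF n ℕP.≤-refl)

-- The first difference loses one degree and one point, so by induction it is zero; F is then
-- constant with value F 0.
vanishing : ∀ k {F : ℕ → ℚ} → DegLess k F → (∀ n → n < k → F n ≡ 0ℚ) → ∀ n → F n ≡ 0ℚ
vanishing zero    dF F≡0 n = dF n
vanishing (suc k) {F} dF F≡0 zero    = F≡0 0 (s≤s z≤n)
vanishing (suc k) {F} dF F≡0 (suc n) = begin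
  F (suc n)                      ≡⟨ solve 2 (λ a b → a := (a :- b) :+ b) refl (F (suc n)) (F n) ⟩
  (F (suc n) -ℚ F n) +ℚ F n      ≡⟨ cong₂ _+ℚ_
                                      (vanishing k dF (λ j j<k → cong₂ _-ℚ_ (F≡0 (suc j) (s≤s j<k)) (F≡0 j (ℕP.m≤n⇒m≤1+n j<k))) n)
                                      (vanishing (suc k) {F} dF F≡0 n) ⟩
  0ℚ ∎
  where
  open ≡-Reasoning
  open ℚSolver

DegLess-unique : ∀ k {F G : ℕ → ℚ} → DegLess k F → DegLess k G → (∀ n → n < k → F n ≡ G n) → ∀ n → F n ≡ G n
DegLess-unique k {F} {G} dF dG F≡G n = begin
  F n                         ≡⟨ solve 2 (λ a b → a := (a :+ con (-ℚ 1ℚ) :* b) :+ b) refl (F n) (G n) ⟩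
  (F n +ℚ -ℚ 1ℚ *ℚ G n) +ℚ G n ≡⟨ cong (_+ℚ G n) (vanishing k (DegLess-+ k dF (DegLess-*ˡ k (-ℚ 1ℚ) dG))
                                   (λ j j<k → trans (cong (_+ℚ -ℚ 1ℚ *ℚ G j) (F≡G j j<k))
                                      (solve 1 (λ b → b :+ con (-ℚ 1ℚ) :* b := con 0ℚ) refl (G j))) n) ⟩
  0ℚ +ℚ G n                   ≡⟨ ℚP.+-identityˡ (G n) ⟩
  G n ∎
  where
  open ≡-Reasoning
  open ℚSolver

-- The symmetric form of the sum

-- newton e X = Σ_l (e choose l) X(l).
newton : ℕ → (ℕ → ℚ) → ℚ
newton zero    X = X 0
newton (suc e) X = newton e X +ℚ newton e (λ l → X (suc l))

newton-cong : ∀ e {X Y : ℕ → ℚ} → (∀ l → X l ≡ Y l) → newton e X ≡ newton e Y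
newton-cong zero    X≗Y = X≗Y 0
newton-cong (suc e) X≗Y = cong₂ _+ℚ_ (newton-cong e X≗Y) (newton-cong e (λ l → X≗Y (suc l)))

newton-0 : ∀ e → newton e (λ _ → 0ℚ) ≡ 0ℚ
newton-0 zero    = refl
newton-0 (suc e) = cong₂ _+ℚ_ (newton-0 e) (newton-0 e)

newton-+ : ∀ e (X Y : ℕ → ℚ) → newton e (λ l → X l +ℚ Y l) ≡ newton e X +ℚ newton e Y
newton-+ zero    X Y = refl
newton-+ (suc e) X Y = trans (cong₂ _+ℚ_ (newton-+ e X Y) (newton-+ e (λ l → X (suc l)) (λ l → Y (suc l))))
  (+ℚ-interchange (newton e X) (newton e Y) (newton e (λ l → X (suc l))) (newton e (λ l → Y (suc l))))

newton-*ˡ : ∀ e c (X : ℕ → ℚ) → newton e (λ l → c *ℚ X l) ≡ c *ℚ newton e X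
newton-*ˡ zero    c X = refl
newton-*ˡ (suc e) c X = trans (cong₂ _+ℚ_ (newton-*ˡ e c X) (newton-*ˡ e c (λ l → X (suc l))))
  (sym (ℚP.*-distribˡ-+ c (newton e X) (newton e (λ l → X (suc l)))))

newton-Sum : ∀ e n (X : ℕ → ℕ → ℚ) → Sum n (λ h → newton e (X h)) ≡ newton e (λ l → Sum n (λ h → X h l))
newton-Sum e zero    X = sym (newton-0 e)
newton-Sum e (suc n) X = trans (cong (_+ℚ newton e (X n)) (newton-Sum e n X))
  (sym (newton-+ e (λ l → Sum n (λ h → X h l)) (X n)))

νC : ℕ → ℕ → ℚ
νC n k = ν (n C k)

νC-pascal : ∀ n k → νC n k +ℚ νC n (suc k) ≡ νC (suc n) (suc k)
νC-pascal n k = trans (sym (ν-+ (n C k) (n C suc k))) (cong ν (nCk+nC[k+1]≡[n+1]C[k+1] n k))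

νC-> : ∀ {n k} → n < k → νC n k ≡ 0ℚ
νC-> n<k = trans (cong ν (k>n⇒nCk≡0 n<k)) ι-0

νC-0 : ∀ n → νC n 0 ≡ 1ℚ
νC-0 n = trans (cong ν (nC0≡1 n)) ι-1

νC-refl : ∀ n → νC n n ≡ 1ℚ
νC-refl n = trans (cong ν (nCn≡1 n)) ι-1

-- Vandermonde's identity with (e choose l) built into `newton`; each step of the recursion on e is
-- one use of Pascal's rule.
newton-C : ∀ e h r → newton e (λ l → νC h (l + r)) ≡ νC (h + e) (e + r)
newton-C zero    h r = cong (λ x → νC x r) (sym (ℕP.+-identityʳ h))
newton-C (suc e) h r = begin
  newton e (λ l → νC h (l + r)) +ℚ newton e (λ l → νC h (suc l + r))
    ≡⟨ cong (newton e (λ l → νC h (l + r)) +ℚ_) (newton-cong e (λ l → cong (νC h) (sym (ℕP.+-suc l r)))) ⟩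
  newton e (λ l → νC h (l + r)) +ℚ newton e (λ l → νC h (l + suc r))
    ≡⟨ cong₂ _+ℚ_ (newton-C e h r) (trans (newton-C e h (suc r)) (cong (νC (h + e)) (ℕP.+-suc e r))) ⟩
  νC (h + e) (e + r) +ℚ νC (h + e) (suc (e + r))
    ≡⟨ νC-pascal (h + e) (e + r) ⟩
  νC (suc (h + e)) (suc (e + r))
    ≡⟨ cong (λ x → νC x (suc (e + r))) (sym (ℕP.+-suc h e)) ⟩
  νC (h + suc e) (suc e + r) ∎
  where open ≡-Reasoning

W : ℕ → ℕ → ℚ
W i h = ν (multichoose i h)

W-0ʳ : ∀ i → W i 0 ≡ 1ℚ
W-0ʳ i = ι-1

W-0ˡ : ∀ h → W 0 (suc h) ≡ 0ℚ
W-0ˡ h = ι-0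

W-pascal : ∀ i h → W (suc i) (suc h) ≡ W i (suc h) +ℚ W (suc i) h
W-pascal i h = ν-+ (multichoose i (suc h)) (multichoose (suc i) h)

W-suc : ∀ i h → ν (suc h) *ℚ W i (suc h) ≡ ν (i + h) *ℚ W i h
W-suc i h = trans (sym (ν-* (suc h) (multichoose i (suc h))))
  (trans (cong ν (multichoose-suc i h)) (ν-* (i + h) (multichoose i h)))

W≡νC : ∀ a x → W (suc a) x ≡ νC (x + a) x
W≡νC a x = cong ν (trans (multichoose≡C a x) (cong (_C x) (ℕP.+-comm a x)))

W≡newton : ∀ e h → W (suc e) h ≡ newton e (λ l → νC h l)
W≡newton e h = begin
  W (suc e) h                      ≡⟨ W≡νC e h ⟩
  νC (h + e) h                     ≡⟨ cong ν (nCk≡nC[n∸k] (ℕP.m≤m+n h e)) ⟩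
  νC (h + e) (h + e ∸ h)           ≡⟨ cong (νC (h + e)) (trans (ℕP.m+n∸m≡n h e) (sym (ℕP.+-identityʳ e))) ⟩
  νC (h + e) (e + 0)               ≡⟨ sym (newton-C e h 0) ⟩
  newton e (λ l → νC h (l + 0))    ≡⟨ newton-cong e (λ l → cong (νC h) (ℕP.+-identityʳ l)) ⟩
  newton e (λ l → νC h l) ∎
  where open ≡-Reasoning

-- For l ≤ n both sides are the trinomial coefficient (a+n)! / (a! l! (n-l)!); otherwise both are 0.
trinomial : ∀ a n l → W (suc a) n *ℚ νC n l ≡ W (suc a) l *ℚ νC (a + n) (a + l)
trinomial a n l with l ≤? n
... | no l≰n = trans (zeroʳ (W (suc a) n) (νC-> (ℕP.≰⇒> l≰n)))
                     (sym (zeroʳ (W (suc a) l) (νC-> (ℕP.+-monoʳ-< a (ℕP.≰⇒> l≰n)))))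
  where
  zeroʳ : ∀ x {y} → y ≡ 0ℚ → x *ℚ y ≡ 0ℚ
  zeroʳ x refl = ℚP.*-zeroʳ x
... | yes l≤n = subst (λ n → W (suc a) n *ℚ νC n l ≡ W (suc a) l *ℚ νC (a + n) (a + l)) (ℕP.m+[n∸m]≡n l≤n) (go (n ∸ l))
  where
  open ≡-Reasoning
  go : ∀ r → W (suc a) (l + r) *ℚ νC (l + r) l ≡ W (suc a) l *ℚ νC (a + (l + r)) (a + l)
  go r = begin
    W (suc a) (l + r) *ℚ νC (l + r) l
      ≡⟨ cong₂ _*ℚ_ (trans (W≡νC a (l + r)) (ν-C (l + r) a)) (ν-C l r) ⟩
    (fact (l + r + a) *ℚ (invFact (l + r) *ℚ invFact a)) *ℚ (fact (l + r) *ℚ (invFact l *ℚ invFact r))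
      ≡⟨ solve 6 (λ f g b h c d → (f :* (g :* b)) :* (h :* (c :* d)) := (h :* g) :* (f :* b :* c :* d)) refl
           (fact (l + r + a)) (invFact (l + r)) (invFact a) (fact (l + r)) (invFact l) (invFact r) ⟩
    (fact (l + r) *ℚ invFact (l + r)) *ℚ (fact (l + r + a) *ℚ invFact a *ℚ invFact l *ℚ invFact r)
      ≡⟨ cong₂ _*ℚ_ (trans (fact*invFact (l + r)) (sym (fact*invFact (l + a))))
           (cong (λ x → fact x *ℚ invFact a *ℚ invFact l *ℚ invFact r) eq) ⟩
    (fact (l + a) *ℚ invFact (l + a)) *ℚ (fact (a + l + r) *ℚ invFact a *ℚ invFact l *ℚ invFact r)
      ≡⟨ solve 6 (λ f g b h c d → (h :* g) :* (f :* b :* c :* d) := (h :* (c :* b)) :* (f :* (g :* d))) refl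
           (fact (a + l + r)) (invFact (l + a)) (invFact a) (fact (l + a)) (invFact l) (invFact r) ⟩
    (fact (l + a) *ℚ (invFact l *ℚ invFact a)) *ℚ (fact (a + l + r) *ℚ (invFact (l + a) *ℚ invFact r))
      ≡⟨ cong₂ _*ℚ_ (sym (trans (W≡νC a l) (ν-C l a)))
           (trans (cong (λ x → fact (a + l + r) *ℚ (invFact x *ℚ invFact r)) (ℕP.+-comm l a)) (sym (ν-C (a + l) r))) ⟩
    W (suc a) l *ℚ νC (a + l + r) (a + l)
      ≡⟨ cong (λ x → W (suc a) l *ℚ νC x (a + l)) (ℕP.+-assoc a l r) ⟩
    W (suc a) l *ℚ νC (a + (l + r)) (a + l) ∎
    where
    open ℚSolver
    eq : l + r + a ≡ a + l + r
    eq = trans (ℕP.+-comm (l + r) a) (sym (ℕP.+-assoc a l r))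

-- For j > 0, `trinomial` extracts the constant factor `W j l` from each summand and leaves a
-- hockey-stick sum. For j = 0 only h = 0 contributes.
Sum-W*C : ∀ j l k → Sum (suc k) (λ h → W j h *ℚ νC h l) ≡ W j l *ℚ νC (j + k) (j + l)
Sum-W*C j zero zero = trans (ℚP.+-identityˡ _)
  (cong (W j 0 *ℚ_) (trans (νC-0 0) (sym (νC-refl (j + 0)))))
Sum-W*C j (suc l) zero = trans (ℚP.+-identityˡ _)
  (trans (cong (W j 0 *ℚ_) (νC-> {0} {suc l} (s≤s z≤n))) (trans (ℚP.*-zeroʳ (W j 0))
    (sym (trans (cong (W j (suc l) *ℚ_) (νC-> {j + 0} {j + suc l} (ℕP.+-monoʳ-< j (s≤s z≤n)))) (ℚP.*-zeroʳ (W j (suc l)))))))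
Sum-W*C zero zero (suc k) = trans
  (cong₂ _+ℚ_ (Sum-W*C zero zero k) (trans (cong (_*ℚ νC (suc k) 0) (W-0ˡ k)) (ℚP.*-zeroˡ (νC (suc k) 0))))
  (trans (ℚP.+-identityʳ _) (cong (W 0 0 *ℚ_) (trans (νC-0 k) (sym (νC-0 (suc k))))))
Sum-W*C zero (suc l) (suc k) = trans
  (cong₂ _+ℚ_ (Sum-W*C zero (suc l) k) (trans (cong (_*ℚ νC (suc k) (suc l)) (W-0ˡ k)) (ℚP.*-zeroˡ (νC (suc k) (suc l)))))
  (trans (ℚP.+-identityʳ _) (trans (vanish (νC k (suc l))) (sym (vanish (νC (suc k) (suc l))))))
  where
  vanish : ∀ x → W 0 (suc l) *ℚ x ≡ 0ℚ
  vanish x = trans (cong (_*ℚ x) (W-0ˡ l)) (ℚP.*-zeroˡ x)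
Sum-W*C (suc a) l (suc k) = begin
  Sum (suc k) (λ h → W (suc a) h *ℚ νC h l) +ℚ W (suc a) (suc k) *ℚ νC (suc k) l
    ≡⟨ cong₂ _+ℚ_ (Sum-W*C (suc a) l k) (trans (trinomial a (suc k) l) (cong (λ x → w *ℚ νC x (a + l)) (ℕP.+-suc a k))) ⟩
  w *ℚ νC (suc a + k) (suc a + l) +ℚ w *ℚ νC (suc a + k) (a + l)
    ≡⟨ solve 3 (λ w x y → w :* x :+ w :* y := w :* (y :+ x)) refl w (νC (suc a + k) (suc a + l)) (νC (suc a + k) (a + l)) ⟩
  w *ℚ (νC (suc a + k) (a + l) +ℚ νC (suc a + k) (suc a + l))
    ≡⟨ cong (w *ℚ_) (νC-pascal (suc a + k) (a + l)) ⟩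
  w *ℚ νC (suc (suc a + k)) (suc a + l)
    ≡⟨ cong (λ x → w *ℚ νC (suc x) (suc a + l)) (sym (ℕP.+-suc a k)) ⟩
  w *ℚ νC (suc a + suc k) (suc a + l) ∎
  where
  open ≡-Reasoning
  open ℚSolver
  w = W (suc a) l

-- A second hockey-stick sum, now over k.
Sum-Sum-W*C : ∀ j l m → Sum m (λ k → Sum (suc k) (λ h → W j h *ℚ νC h l)) ≡ W j l *ℚ νC (j + m) (suc (j + l))
Sum-Sum-W*C j l zero = sym (trans (cong (W j l *ℚ_)
  (νC-> (s≤s (ℕP.≤-trans (ℕP.≤-reflexive (ℕP.+-identityʳ j)) (ℕP.m≤m+n j l))))) (ℚP.*-zeroʳ (W j l)))
Sum-Sum-W*C j l (suc m) = begin
  Sum m (λ k → Sum (suc k) (λ h → W j h *ℚ νC h l)) +ℚ Sum (suc m) (λ h → W j h *ℚ νC h l)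
    ≡⟨ cong₂ _+ℚ_ (Sum-Sum-W*C j l m) (Sum-W*C j l m) ⟩
  W j l *ℚ νC (j + m) (suc (j + l)) +ℚ W j l *ℚ νC (j + m) (j + l)
    ≡⟨ solve 3 (λ w x y → w :* x :+ w :* y := w :* (y :+ x)) refl (W j l) (νC (j + m) (suc (j + l))) (νC (j + m) (j + l)) ⟩
  W j l *ℚ (νC (j + m) (j + l) +ℚ νC (j + m) (suc (j + l)))
    ≡⟨ cong (W j l *ℚ_) (νC-pascal (j + m) (j + l)) ⟩
  W j l *ℚ νC (suc (j + m)) (suc (j + l))
    ≡⟨ cong (λ x → W j l *ℚ νC x (suc (j + l))) (sym (ℕP.+-suc j m)) ⟩
  W j l *ℚ νC (j + suc m) (suc (j + l)) ∎
  where
  open ≡-Reasoning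
  open ℚSolver

-- Equals Σ_{h<m} (m - h) (i-1+h choose h) (e-1+h choose h); m times the sum in the
-- theorem, in a form symmetric in i and e = d - i.
symSum : ℕ → ℕ → ℕ → ℚ
symSum m i e = Sum m (λ k → Sum (suc k) (λ h → W i h *ℚ W e h))

symSum-comm : ∀ m i e → symSum m i e ≡ symSum m e i
symSum-comm m i e = Sum-cong m (λ k _ → Sum-cong (suc k) (λ h _ → ℚP.*-comm (W i h) (W e h)))

symSum-0 : ∀ m i → symSum m i 0 ≡ ν m
symSum-0 zero    i = sym ι-0
symSum-0 (suc m) i = trans (cong₂ _+ℚ_ (symSum-0 m i) inner) (trans (ℚP.+-comm (ν m) 1ℚ) (sym (ν-suc m)))
  where
  inner : Sum (suc m) (λ h → W i h *ℚ W 0 h) ≡ 1ℚ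
  inner = trans (Sum-head m (λ h → W i h *ℚ W 0 h)) (trans (cong₂ _+ℚ_
    (trans (cong₂ _*ℚ_ (W-0ʳ i) (W-0ʳ 0)) (ℚP.*-identityˡ 1ℚ))
    (Sum-zero m (λ h _ → trans (cong (W i (suc h) *ℚ_) (W-0ˡ h)) (ℚP.*-zeroʳ (W i (suc h))))))
    (ℚP.+-identityʳ 1ℚ))

-- Only the factor `W (suc e) h` is expanded by Vandermonde, so that the sums over h and k can be
-- carried out before the one over l. Afterwards m occurs in a single binomial coefficient.
symSum≡newton : ∀ m j e → symSum m j (suc e) ≡ newton e (λ l → W j l *ℚ νC (j + m) (suc (j + l)))
symSum≡newton m j e = begin
  Sum m (λ k → Sum (suc k) (λ h → W j h *ℚ W (suc e) h))
    ≡⟨ Sum-cong m (λ k _ → trans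
         (Sum-cong (suc k) (λ h _ → trans (cong (W j h *ℚ_) (W≡newton e h)) (sym (newton-*ˡ e (W j h) (νC h)))))
         (newton-Sum e (suc k) (λ h l → W j h *ℚ νC h l))) ⟩
  Sum m (λ k → newton e (λ l → Sum (suc k) (λ h → W j h *ℚ νC h l)))
    ≡⟨ newton-Sum e m (λ k l → Sum (suc k) (λ h → W j h *ℚ νC h l)) ⟩
  newton e (λ l → Sum m (λ k → Sum (suc k) (λ h → W j h *ℚ νC h l)))
    ≡⟨ newton-cong e (λ l → Sum-Sum-W*C j l m) ⟩
  newton e (λ l → W j l *ℚ νC (j + m) (suc (j + l))) ∎
  where open ≡-Reasoning

DegLess-newton : ∀ k e (X : ℕ → ℕ → ℚ) → (∀ l → l ≤ e → DegLess k (X l)) → DegLess k (λ i → newton e (λ l → X l i))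
DegLess-newton k zero    X dX = dX 0 z≤n
DegLess-newton k (suc e) X dX = DegLess-+ k
  (DegLess-newton k e X (λ l l≤e → dX l (ℕP.m≤n⇒m≤1+n l≤e)))
  (DegLess-newton k e (λ l → X (suc l)) (λ l l≤e → dX (suc l) (s≤s l≤e)))

x+y-x≡y : ∀ x y → (x +ℚ y) -ℚ x ≡ y
x+y-x≡y = solve 2 (λ x y → (x :+ y) :- x := y) refl
  where open ℚSolver

DegLess-W : ∀ l → DegLess (suc l) (λ i → W i l)
DegLess-W zero    i = ℚP.+-inverseʳ (W i 0)
DegLess-W (suc l) = DegLess-cong (suc l)
  (λ i → sym (trans (cong (_-ℚ W i (suc l)) (W-pascal i l)) (x+y-x≡y (W i (suc l)) (W (suc i) l))))
  (DegLess-∘suc (suc l) {λ i → W i l} (DegLess-W l))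

DegLess-C : ∀ j → DegLess (suc j) (λ i → νC i j)
DegLess-C zero i = trans (cong₂ _-ℚ_ (νC-0 (suc i)) (νC-0 i)) (ℚP.+-inverseʳ 1ℚ)
DegLess-C (suc j) = DegLess-cong (suc j)
  (λ i → sym (trans (cong (_-ℚ νC i (suc j)) (trans (sym (νC-pascal i j)) (ℚP.+-comm (νC i j) (νC i (suc j)))))
                    (x+y-x≡y (νC i (suc j)) (νC i j))))
  (DegLess-C j)

-- The quotient of factorials is a product of s linear factors in i, and `W i l` has degree l; the
-- total degree l + s is just below the bound.
DegLess-rising : ∀ l s → DegLess (suc l + s) (λ i → fact (i + (suc l + s)) *ℚ invFact (i + suc l) *ℚ W i l)
DegLess-rising l zero = subst (λ k → DegLess k (λ i → fact (i + k) *ℚ invFact (i + suc l) *ℚ W i l))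
  (sym (ℕP.+-identityʳ (suc l)))
  (DegLess-cong (suc l) (λ i → sym (trans (cong (_*ℚ W i l) (fact*invFact (i + suc l))) (ℚP.*-identityˡ (W i l))))
    (DegLess-W l))
DegLess-rising l (suc s) = subst (λ k → DegLess k (λ i → fact (i + k) *ℚ invFact (i + suc l) *ℚ W i l))
  (sym (ℕP.+-suc (suc l) s))
  (DegLess-cong (suc (suc l + s))
    (λ i → trans (solve 4 (λ n f g w → n :* (f :* g :* w) := n :* f :* g :* w) refl
                   (ν (i + suc (suc l + s))) (fact (i + (suc l + s))) (invFact (i + suc l)) (W i l))
                 (cong (λ x → x *ℚ invFact (i + suc l) *ℚ W i l) (step i (suc l + s))))
    (DegLess-linear (suc l + s) (suc (suc l + s)) (DegLess-rising l s)))
  where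
  open ℚSolver
  step : ∀ i k → ν (i + suc k) *ℚ fact (i + k) ≡ fact (i + suc k)
  step i k = trans (cong (λ x → ν x *ℚ fact (i + k)) (ℕP.+-suc i k))
    (trans (sym (fact-suc (i + k))) (cong fact (sym (ℕP.+-suc i k))))

-- In the l-th term of `symSum≡newton` the factor (i+m)! of the binomial coefficient cancels the
-- denominator, leaving (i+e+1)! / (i+l+1)! times `W i l` and a constant. For l ≥ m the binomial
-- coefficient is 0.
DegLess-symSum : ∀ m e → DegLess (suc e) (λ i → fact (i + suc e) *ℚ (invFact (i + m) *ℚ symSum m i (suc e)))
DegLess-symSum m e = DegLess-cong (suc e)
  (λ i → trans (newton-*ˡ e (fact (i + suc e) *ℚ invFact (i + m)) (λ l → W i l *ℚ νC (i + m) (suc (i + l))))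
    (trans (ℚP.*-assoc (fact (i + suc e)) (invFact (i + m)) _)
           (cong (λ x → fact (i + suc e) *ℚ (invFact (i + m) *ℚ x)) (sym (symSum≡newton m i e)))))
  (DegLess-newton (suc e) e term dTerm)
  where
  term : ℕ → ℕ → ℚ
  term l i = (fact (i + suc e) *ℚ invFact (i + m)) *ℚ (W i l *ℚ νC (i + m) (suc (i + l)))

  large : ∀ l → m ≤ l → DegLess (suc e) (term l)
  large l m≤l = DegLess-zero (suc e) (λ i → trans
    (cong (λ x → (fact (i + suc e) *ℚ invFact (i + m)) *ℚ (W i l *ℚ x)) (νC-> (s≤s (ℕP.+-monoʳ-≤ i m≤l))))
    (trans (cong ((fact (i + suc e) *ℚ invFact (i + m)) *ℚ_) (ℚP.*-zeroʳ (W i l))) (ℚP.*-zeroʳ (fact (i + suc e) *ℚ invFact (i + m)))))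

  small : ∀ l r s → suc l + r ≡ m → suc l + s ≡ suc e → DegLess (suc e) (term l)
  small l r s eq-m eq-e = subst (λ k → DegLess k (term l)) eq-e (DegLess-cong (suc l + s) eq
    (DegLess-*ˡ (suc l + s) (invFact r) (DegLess-rising l s)))
    where
    open ≡-Reasoning
    open ℚSolver
    eq : ∀ i → invFact r *ℚ (fact (i + (suc l + s)) *ℚ invFact (i + suc l) *ℚ W i l) ≡ term l i
    eq i = begin
      invFact r *ℚ (fact (i + (suc l + s)) *ℚ invFact (i + suc l) *ℚ W i l)
        ≡⟨ solve 4 (λ r f g w → r :* (f :* g :* w) := (con 1ℚ :* f) :* (w :* (g :* r))) refl
             (invFact r) (fact (i + (suc l + s))) (invFact (i + suc l)) (W i l) ⟩
      (1ℚ *ℚ fact (i + (suc l + s))) *ℚ (W i l *ℚ (invFact (i + suc l) *ℚ invFact r))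
        ≡⟨ cong₂ (λ x y → (x *ℚ fact (i + y)) *ℚ (W i l *ℚ (invFact (i + suc l) *ℚ invFact r)))
             (sym (fact*invFact (i + m))) eq-e ⟩
      ((fact (i + m) *ℚ invFact (i + m)) *ℚ fact (i + suc e)) *ℚ (W i l *ℚ (invFact (i + suc l) *ℚ invFact r))
        ≡⟨ solve 5 (λ a b f w x → ((a :* b) :* f) :* (w :* x) := (f :* b) :* (w :* (a :* x))) refl
             (fact (i + m)) (invFact (i + m)) (fact (i + suc e)) (W i l) (invFact (i + suc l) *ℚ invFact r) ⟩
      (fact (i + suc e) *ℚ invFact (i + m)) *ℚ (W i l *ℚ (fact (i + m) *ℚ (invFact (i + suc l) *ℚ invFact r)))
        ≡⟨ cong (λ x → (fact (i + suc e) *ℚ invFact (i + m)) *ℚ (W i l *ℚ x)) C≡ ⟩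
      term l i ∎
      where
      i+m≡ : i + suc l + r ≡ i + m
      i+m≡ = trans (ℕP.+-assoc i (suc l) r) (cong (λ x → i + x) eq-m)
      C≡ : fact (i + m) *ℚ (invFact (i + suc l) *ℚ invFact r) ≡ νC (i + m) (suc (i + l))
      C≡ = trans (cong (λ x → fact x *ℚ (invFact (i + suc l) *ℚ invFact r)) (sym i+m≡))
        (trans (sym (ν-C (i + suc l) r)) (cong₂ νC i+m≡ (ℕP.+-suc i l)))

  dTerm : ∀ l → l ≤ e → DegLess (suc e) (term l)
  dTerm l l≤e with m ≤? l
  ... | yes m≤l = large l m≤l
  ... | no m≰l = small l (m ∸ suc l) (suc e ∸ suc l) (ℕP.m+[n∸m]≡n (ℕP.≰⇒> m≰l)) (ℕP.m+[n∸m]≡n (s≤s l≤e))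

-- Summation by parts

module _ (i e : ℕ) where
  private
    V : ℕ → ℚ
    V h = W i (suc h) -ℚ W i h

    A B : ℕ → ℚ
    A m = Sum m (λ h → W i h *ℚ W (suc e) h)
    B m = Sum m (λ h → V h *ℚ W (suc e) h)

  -- Abel summation: by Pascal's rule `W e h` is the difference in h of `W (suc e) h`, and the
  -- difference is moved to the other factor.
  Sum-by-parts : ∀ k → Sum (suc k) (λ h → W i h *ℚ W e h) ≡ W i k *ℚ W (suc e) k -ℚ B k
  Sum-by-parts zero    = solve 1 (λ x → con 0ℚ :+ x := x :- con 0ℚ) refl (W i 0 *ℚ W e 0)
    where open ℚSolver
  Sum-by-parts (suc k) = begin
    Sum (suc k) (λ h → W i h *ℚ W e h) +ℚ W i (suc k) *ℚ W e (suc k)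
      ≡⟨ cong (_+ℚ W i (suc k) *ℚ W e (suc k)) (Sum-by-parts k) ⟩
    (w *ℚ x -ℚ B k) +ℚ w′ *ℚ y
      ≡⟨ solve 5 (λ w w′ x y b → (w :* x :- b) :+ w′ :* y := w′ :* (y :+ x) :- (b :+ (w′ :- w) :* x)) refl w w′ x y (B k) ⟩
    w′ *ℚ (y +ℚ x) -ℚ (B k +ℚ (w′ -ℚ w) *ℚ x)
      ≡⟨ cong (λ t → w′ *ℚ t -ℚ (B k +ℚ (w′ -ℚ w) *ℚ x)) (sym (W-pascal e k)) ⟩
    w′ *ℚ W (suc e) (suc k) -ℚ B (suc k) ∎
    where
    open ≡-Reasoning
    open ℚSolver
    w = W i k
    w′ = W i (suc k)
    x = W (suc e) k
    y = W e (suc k)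

  -- Raising m by one changes the left side by ((i+m+1) w - (m+1) w′) x - B m. Since (m+1) w′ =
  -- (i+m) w, this is w x - B m, the next inner sum of `symSum` by `Sum-by-parts`.
  A-B≡symSum : ∀ m → ν i *ℚ A m -ℚ ν m *ℚ B m ≡ symSum m i e
  A-B≡symSum zero    = solve 2 (λ x y → x :* con 0ℚ :- y :* con 0ℚ := con 0ℚ) refl (ν i) (ν 0)
    where open ℚSolver
  A-B≡symSum (suc m) = begin
    ν i *ℚ (A m +ℚ w *ℚ x) -ℚ ν (suc m) *ℚ (B m +ℚ (w′ -ℚ w) *ℚ x)
      ≡⟨ solve 7 (λ i n a b w w′ x → i :* (a :+ w :* x) :- n :* (b :+ (w′ :- w) :* x)
                  := i :* (a :+ w :* x) :- n :* b :- (n :* w′) :* x :+ n :* w :* x) refl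
           (ν i) (ν (suc m)) (A m) (B m) w w′ x ⟩
    ν i *ℚ (A m +ℚ w *ℚ x) -ℚ ν (suc m) *ℚ B m -ℚ (ν (suc m) *ℚ w′) *ℚ x +ℚ ν (suc m) *ℚ w *ℚ x
      ≡⟨ cong₂ (λ s t → ν i *ℚ (A m +ℚ w *ℚ x) -ℚ s *ℚ B m -ℚ t *ℚ x +ℚ s *ℚ w *ℚ x)
           (ν-suc m) (trans (W-suc i m) (cong (_*ℚ w) (ν-+ i m))) ⟩
    ν i *ℚ (A m +ℚ w *ℚ x) -ℚ (1ℚ +ℚ ν m) *ℚ B m -ℚ ((ν i +ℚ ν m) *ℚ w) *ℚ x +ℚ (1ℚ +ℚ ν m) *ℚ w *ℚ x
      ≡⟨ solve 6 (λ i n a b w x → i :* (a :+ w :* x) :- (con 1ℚ :+ n) :* b :- ((i :+ n) :* w) :* x :+ (con 1ℚ :+ n) :* w :* x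
                  := (i :* a :- n :* b) :+ (w :* x :- b)) refl (ν i) (ν m) (A m) (B m) w x ⟩
    (ν i *ℚ A m -ℚ ν m *ℚ B m) +ℚ (w *ℚ x -ℚ B m)
      ≡⟨ cong₂ _+ℚ_ (A-B≡symSum m) (sym (Sum-by-parts m)) ⟩
    symSum (suc m) i e ∎
    where
    open ≡-Reasoning
    open ℚSolver
    w = W i m
    w′ = W i (suc m)
    x = W (suc e) m

  -- Up to the factor 1/m the left side is the sum of the theorem at e = d - i, with its weights
  -- rewritten by `weight≡`.
  Sum≡symSum : ∀ m → Sum m (λ h → (ν i *ℚ W i h -ℚ ν m *ℚ (W i (suc h) -ℚ W i h)) *ℚ W (suc e) h) ≡ symSum m i e
  Sum≡symSum m = begin
    Sum m (λ h → (ν i *ℚ W i h -ℚ ν m *ℚ V h) *ℚ W (suc e) h)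
      ≡⟨ Sum-cong m (λ h _ → solve 5 (λ i n w v x → (i :* w :- n :* v) :* x := i :* (w :* x) :+ (:- n) :* (v :* x)) refl
           (ν i) (ν m) (W i h) (V h) (W (suc e) h)) ⟩
    Sum m (λ h → ν i *ℚ (W i h *ℚ W (suc e) h) +ℚ (-ℚ ν m) *ℚ (V h *ℚ W (suc e) h))
      ≡⟨ Sum-+ m (λ h → ν i *ℚ (W i h *ℚ W (suc e) h)) (λ h → (-ℚ ν m) *ℚ (V h *ℚ W (suc e) h)) ⟩
    Sum m (λ h → ν i *ℚ (W i h *ℚ W (suc e) h)) +ℚ Sum m (λ h → (-ℚ ν m) *ℚ (V h *ℚ W (suc e) h))
      ≡⟨ cong₂ _+ℚ_ (Sum-*ˡ m (ν i) (λ h → W i h *ℚ W (suc e) h)) (Sum-*ˡ m (-ℚ ν m) (λ h → V h *ℚ W (suc e) h)) ⟩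
    ν i *ℚ A m +ℚ (-ℚ ν m) *ℚ B m
      ≡⟨ solve 3 (λ a n b → a :+ (:- n) :* b := a :- n :* b) refl (ν i *ℚ A m) (ν m) (B m) ⟩
    ν i *ℚ A m -ℚ ν m *ℚ B m
      ≡⟨ A-B≡symSum m ⟩
    symSum m i e ∎
    where
    open ≡-Reasoning
    open ℚSolver

-- Interpolation of the rows

-- The cutoff L does not depend on N. This keeps the number of terms fixed while i, and with it the
-- size of the ground set, varies.
ι-bsum : ∀ N L (φ : ℕ → ℤ) → (∀ b → L ≤ b → φ b ≡ Z.+ 0) →
  ι (bsum N (λ _ b → φ b)) ≡ Sum L (λ b → νC N b *ℚ ι (φ b))
ι-bsum zero    zero    φ φ≡0 = trans (cong ι (φ≡0 0 z≤n)) ι-0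
ι-bsum zero    (suc L) φ φ≡0 = sym (trans (Sum-head L (λ b → νC 0 b *ℚ ι (φ b)))
  (trans (cong₂ _+ℚ_ (trans (cong (_*ℚ ι (φ 0)) (νC-0 0)) (ℚP.*-identityˡ (ι (φ 0))))
    (Sum-zero L (λ b _ → trans (cong (_*ℚ ι (φ (suc b))) (νC-> {0} {suc b} (s≤s z≤n))) (ℚP.*-zeroˡ (ι (φ (suc b)))))))
  (ℚP.+-identityʳ (ι (φ 0)))))
ι-bsum (suc N) zero    φ φ≡0 = trans (cong ι (trans (bsum-cong (suc N) (λ _ b _ → φ≡0 b z≤n)) (bsum-zero (suc N)))) ι-0
ι-bsum (suc N) (suc L) φ φ≡0 = begin
  ι (bsum N (λ _ b → φ b) +ℤ bsum N (λ _ b → φ (suc b)))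
    ≡⟨ ι-+ (bsum N (λ _ b → φ b)) (bsum N (λ _ b → φ (suc b))) ⟩
  ι (bsum N (λ _ b → φ b)) +ℚ ι (bsum N (λ _ b → φ (suc b)))
    ≡⟨ cong₂ _+ℚ_ (trans (ι-bsum N (suc L) φ φ≡0) (Sum-head L (λ b → νC N b *ℚ ι (φ b))))
         (ι-bsum N L (λ b → φ (suc b)) (λ b L≤b → φ≡0 (suc b) (s≤s L≤b))) ⟩
  (νC N 0 *ℚ ι (φ 0) +ℚ Sum L (λ b → νC N (suc b) *ℚ ι (φ (suc b)))) +ℚ Sum L (λ b → νC N b *ℚ ι (φ (suc b)))
    ≡⟨ ℚP.+-assoc (νC N 0 *ℚ ι (φ 0)) _ _ ⟩
  νC N 0 *ℚ ι (φ 0) +ℚ (Sum L (λ b → νC N (suc b) *ℚ ι (φ (suc b))) +ℚ Sum L (λ b → νC N b *ℚ ι (φ (suc b))))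
    ≡⟨ cong₂ _+ℚ_ (cong (_*ℚ ι (φ 0)) (trans (νC-0 N) (sym (νC-0 (suc N)))))
         (trans (sym (Sum-+ L (λ b → νC N (suc b) *ℚ ι (φ (suc b))) (λ b → νC N b *ℚ ι (φ (suc b)))))
           (Sum-cong L (λ b _ → trans
             (solve 3 (λ x y z → x :* z :+ y :* z := (y :+ x) :* z) refl (νC N (suc b)) (νC N b) (ι (φ (suc b))))
             (cong (_*ℚ ι (φ (suc b))) (νC-pascal N b))))) ⟩
  νC (suc N) 0 *ℚ ι (φ 0) +ℚ Sum L (λ b → νC (suc N) (suc b) *ℚ ι (φ (suc b)))
    ≡⟨ sym (Sum-head L (λ b → νC (suc N) b *ℚ ι (φ b))) ⟩
  Sum (suc L) (λ b → νC (suc N) b *ℚ ι (φ b)) ∎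
  where
  open ≡-Reasoning
  open ℚSolver

-- For j ≤ i both sides are i! / ((n+j)! (i-j)!). The normalising factor thus turns a binomial
-- coefficient that depends on i through a large ground set into (i choose j) times a constant.
νC-shift : ∀ n i j → νC (n + i) (n + j) *ℚ (fact i *ℚ invFact (n + i)) ≡ νC i j *ℚ (fact j *ℚ invFact (n + j))
νC-shift n i j with j ≤? i
... | no j≰i = trans (vanish (νC-> (ℕP.+-monoʳ-< n (ℕP.≰⇒> j≰i)))) (sym (vanish (νC-> (ℕP.≰⇒> j≰i))))
  where
  vanish : ∀ {x y} → x ≡ 0ℚ → x *ℚ y ≡ 0ℚ
  vanish {y = y} refl = ℚP.*-zeroˡ y
... | yes j≤i = subst (λ i → νC (n + i) (n + j) *ℚ (fact i *ℚ invFact (n + i)) ≡ νC i j *ℚ (fact j *ℚ invFact (n + j)))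
                  (ℕP.m+[n∸m]≡n j≤i) (go (i ∸ j))
  where
  open ≡-Reasoning
  open ℚSolver
  go : ∀ r → νC (n + (j + r)) (n + j) *ℚ (fact (j + r) *ℚ invFact (n + (j + r))) ≡ νC (j + r) j *ℚ (fact j *ℚ invFact (n + j))
  go r = begin
    νC (n + (j + r)) (n + j) *ℚ (fi *ℚ invFact (n + (j + r)))
      ≡⟨ cong (λ x → νC x (n + j) *ℚ (fi *ℚ invFact x)) (sym (ℕP.+-assoc n j r)) ⟩
    νC (n + j + r) (n + j) *ℚ (fi *ℚ gN)
      ≡⟨ cong (_*ℚ (fi *ℚ gN)) (ν-C (n + j) r) ⟩
    (fN *ℚ (gnj *ℚ gr)) *ℚ (fi *ℚ gN)
      ≡⟨ solve 5 (λ a b c d e → (a :* (b :* c)) :* (d :* e) := (a :* e) :* (b :* c :* d)) refl fN gnj gr fi gN ⟩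
    (fN *ℚ gN) *ℚ (gnj *ℚ gr *ℚ fi)
      ≡⟨ cong (_*ℚ (gnj *ℚ gr *ℚ fi)) (trans (fact*invFact (n + j + r)) (sym (fact*invFact j))) ⟩
    (fact j *ℚ invFact j) *ℚ (gnj *ℚ gr *ℚ fi)
      ≡⟨ solve 5 (λ a e b c d → (a :* e) :* (b :* c :* d) := (d :* (e :* c)) :* (a :* b)) refl (fact j) (invFact j) gnj gr fi ⟩
    (fi *ℚ (invFact j *ℚ gr)) *ℚ (fact j *ℚ gnj)
      ≡⟨ cong (_*ℚ (fact j *ℚ gnj)) (sym (ν-C j r)) ⟩
    νC (j + r) j *ℚ (fact j *ℚ gnj) ∎
    where
    fi = fact (j + r)
    fN = fact (n + j + r)
    gN = invFact (n + j + r)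
    gnj = invFact (n + j)
    gr = invFact r

module Formula (P : Mat → Poly) (isKL : IsKL P) (m : ℕ) (1≤m : 1 ≤ m) where
  open KL P isKL m 1≤m

  z : ℕ → ℕ → ℚ
  z e i = ι (Z P (U m (e + i)) i)

  -- Palindromicity. Rank 0 is excluded because `U m 0` with m ≥ 1 consists of loops, where `IsKL`
  -- says nothing.
  z-comm : ∀ e i → 1 ≤ e + i → z e i ≡ z i e
  z-comm e i 1≤ = cong ι (begin
    Z P (U m (e + i)) i            ≡⟨ sym (Z-palindromic 1≤ (ℕP.m≤n+m i e)) ⟩
    Z P (U m (e + i)) (e + i ∸ i)  ≡⟨ cong (Z P (U m (e + i))) (ℕP.m+n∸n≡m e i) ⟩
    Z P (U m (e + i)) e            ≡⟨ cong (λ d → Z P (U m d) e) (ℕP.+-comm e i) ⟩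
    Z P (U m (i + e)) e ∎)
    where open ≡-Reasoning

  z≡Sum : ∀ {e} i → 1 ≤ e → z e i ≡ Sum e (λ j → νC (m + e + i) (m + e + j) *ℚ ι (diag e (m + e + j)))
  z≡Sum {e} i 1≤e = begin
    ι (Z P (U m (e + i)) i)
      ≡⟨ cong ι (Z≡diag i 1≤e) ⟩
    ι (bsum (m + (e + i)) (λ _ b → diag e b))
      ≡⟨ cong (λ N → ι (bsum N (λ _ b → diag e b))) (sym (ℕP.+-assoc m e i)) ⟩
    ι (bsum (m + e + i) (λ _ b → diag e b))
      ≡⟨ ι-bsum (m + e + i) (m + e + e) (diag e) (λ b → diag-≥ e) ⟩
    Sum (m + e + e) (λ b → νC (m + e + i) b *ℚ ι (diag e b))
      ≡⟨ Sum-split (m + e) e (λ b → νC (m + e + i) b *ℚ ι (diag e b)) ⟩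
    Sum (m + e) (λ b → νC (m + e + i) b *ℚ ι (diag e b)) +ℚ Sum e (λ j → νC (m + e + i) (m + e + j) *ℚ ι (diag e (m + e + j)))
      ≡⟨ cong (_+ℚ Sum e (λ j → νC (m + e + i) (m + e + j) *ℚ ι (diag e (m + e + j))))
           (Sum-zero (m + e) (λ b b<m+e → trans
             (cong (νC (m + e + i) b *ℚ_) (trans (cong ι (diag-< e b<m+e)) ι-0)) (ℚP.*-zeroʳ (νC (m + e + i) b)))) ⟩
    0ℚ +ℚ Sum e (λ j → νC (m + e + i) (m + e + j) *ℚ ι (diag e (m + e + j)))
      ≡⟨ ℚP.+-identityˡ _ ⟩
    Sum e (λ j → νC (m + e + i) (m + e + j) *ℚ ι (diag e (m + e + j))) ∎
    where open ≡-Reasoning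

  DegLess-z : ∀ {e} → 1 ≤ e → DegLess e (λ i → z e i *ℚ (fact i *ℚ invFact (m + e + i)))
  DegLess-z {e} 1≤e = DegLess-cong e
    (λ i → begin
      Sum e (λ j → c j *ℚ νC i j)
        ≡⟨ Sum-cong e (λ j _ → begin
             c j *ℚ νC i j
               ≡⟨ solve 3 (λ x y v → x :* y :* v := x :* (v :* y)) refl (ι (diag e (m + e + j))) (fact j *ℚ invFact (m + e + j)) (νC i j) ⟩
             ι (diag e (m + e + j)) *ℚ (νC i j *ℚ (fact j *ℚ invFact (m + e + j)))
               ≡⟨ cong (ι (diag e (m + e + j)) *ℚ_) (sym (νC-shift (m + e) i j)) ⟩
             ι (diag e (m + e + j)) *ℚ (νC (m + e + i) (m + e + j) *ℚ k i)
               ≡⟨ solve 3 (λ x y v → x :* (y :* v) := v :* (y :* x)) refl (ι (diag e (m + e + j))) (νC (m + e + i) (m + e + j)) (k i) ⟩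
             k i *ℚ (νC (m + e + i) (m + e + j) *ℚ ι (diag e (m + e + j))) ∎) ⟩
      Sum e (λ j → k i *ℚ (νC (m + e + i) (m + e + j) *ℚ ι (diag e (m + e + j))))
        ≡⟨ Sum-*ˡ e (k i) (λ j → νC (m + e + i) (m + e + j) *ℚ ι (diag e (m + e + j))) ⟩
      k i *ℚ Sum e (λ j → νC (m + e + i) (m + e + j) *ℚ ι (diag e (m + e + j)))
        ≡⟨ cong (k i *ℚ_) (sym (z≡Sum i 1≤e)) ⟩
      k i *ℚ z e i
        ≡⟨ ℚP.*-comm (k i) (z e i) ⟩
      z e i *ℚ k i ∎)
    (DegLess-Sum e e (λ j i → c j *ℚ νC i j)
      (λ j j<e → DegLess-*ˡ e (c j) (DegLess-≤ {F = λ i → νC i j} j<e (DegLess-C j))))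
    where
    open ≡-Reasoning
    open ℚSolver
    k c : ℕ → ℚ
    k i = fact i *ℚ invFact (m + e + i)
    c j = ι (diag e (m + e + j)) *ℚ (fact j *ℚ invFact (m + e + j))

  -- The theorem with all denominators cleared, which makes its symmetry in e and i visible.
  Claim : ℕ → ℕ → Set
  Claim e i = ν m *ℚ z e i *ℚ (fact e *ℚ fact i *ℚ (fact (e + m) *ℚ fact (i + m)))
            ≡ fact (m + e + i) *ℚ fact m *ℚ fact (i + e) *ℚ symSum m i e

  Claim-comm : ∀ {e i} → 1 ≤ e + i → Claim e i → Claim i e
  Claim-comm {e} {i} 1≤ claim = begin
    ν m *ℚ z i e *ℚ (fact i *ℚ fact e *ℚ (fact (i + m) *ℚ fact (e + m)))
      ≡⟨ cong₂ (λ x y → ν m *ℚ x *ℚ y) (sym (z-comm e i 1≤))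
           (cong₂ _*ℚ_ (ℚP.*-comm (fact i) (fact e)) (ℚP.*-comm (fact (i + m)) (fact (e + m)))) ⟩
    ν m *ℚ z e i *ℚ (fact e *ℚ fact i *ℚ (fact (e + m) *ℚ fact (i + m)))
      ≡⟨ claim ⟩
    fact (m + e + i) *ℚ fact m *ℚ fact (i + e) *ℚ symSum m i e
      ≡⟨ cong₂ (λ x y → fact x *ℚ fact m *ℚ fact y *ℚ symSum m i e)
           (trans (ℕP.+-assoc m e i) (trans (cong (λ x → m + x) (ℕP.+-comm e i)) (sym (ℕP.+-assoc m i e)))) (ℕP.+-comm i e) ⟩
    fact (m + i + e) *ℚ fact m *ℚ fact (e + i) *ℚ symSum m i e
      ≡⟨ cong (fact (m + i + e) *ℚ fact m *ℚ fact (e + i) *ℚ_) (symSum-comm m i e) ⟩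
    fact (m + i + e) *ℚ fact m *ℚ fact (e + i) *ℚ symSum m e i ∎
    where open ≡-Reasoning

  module _ (e i : ℕ) where
    private
      fe = fact e
      fi = fact i
      fem = fact (e + m)
      fim = fact (i + m)
      gim = invFact (i + m)
      fN = fact (m + e + i)
      gN = invFact (m + e + i)
      fm = fact m
      gm = invFact m
      fie = fact (i + e)
      L R : ℚ
      L = (ν m *ℚ fe *ℚ fem *ℚ gm) *ℚ (z e i *ℚ (fi *ℚ gN))
      R = fie *ℚ (gim *ℚ symSum m i e)
      open ≡-Reasoning
      open ℚSolver

    -- `L ≡ R` is `Claim` divided by (m+e+i)! m! (i+m)!. For fixed e ≥ 1 both L and R are
    -- polynomials in i of degree less than e, by `DegLess-z` and `DegLess-symSum`.
    Claim⇒ : Claim e i → L ≡ R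
    Claim⇒ claim = begin
      L
        ≡⟨ solve 1 (λ l → l := l :* con 1ℚ) refl L ⟩
      L *ℚ 1ℚ
        ≡⟨ cong (L *ℚ_) (sym (fact*invFact (i + m))) ⟩
      L *ℚ (fim *ℚ gim)
        ≡⟨ solve 9 (λ n fe fem gm z fi gN fim gim → ((n :* fe :* fem :* gm) :* (z :* (fi :* gN))) :* (fim :* gim)
                    := (n :* z :* (fe :* fi :* (fem :* fim))) :* (gm :* gN :* gim)) refl
             (ν m) fe fem gm (z e i) fi gN fim gim ⟩
      (ν m *ℚ z e i *ℚ (fe *ℚ fi *ℚ (fem *ℚ fim))) *ℚ (gm *ℚ gN *ℚ gim)
        ≡⟨ cong (_*ℚ (gm *ℚ gN *ℚ gim)) claim ⟩
      (fN *ℚ fm *ℚ fie *ℚ symSum m i e) *ℚ (gm *ℚ gN *ℚ gim)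
        ≡⟨ solve 7 (λ fN fm fie M gm gN gim → (fN :* fm :* fie :* M) :* (gm :* gN :* gim)
                    := ((fN :* gN) :* (fm :* gm)) :* (fie :* (gim :* M))) refl fN fm fie (symSum m i e) gm gN gim ⟩
      ((fN *ℚ gN) *ℚ (fm *ℚ gm)) *ℚ R
        ≡⟨ cong₂ (λ x y → (x *ℚ y) *ℚ R) (fact*invFact (m + e + i)) (fact*invFact m) ⟩
      (1ℚ *ℚ 1ℚ) *ℚ R
        ≡⟨ solve 1 (λ r → (con 1ℚ :* con 1ℚ) :* r := r) refl R ⟩
      R ∎

    Claim⇐ : L ≡ R → Claim e i
    Claim⇐ eq = begin
      ν m *ℚ z e i *ℚ (fe *ℚ fi *ℚ (fem *ℚ fim))
        ≡⟨ solve 1 (λ l → l := l :* (con 1ℚ :* con 1ℚ)) refl (ν m *ℚ z e i *ℚ (fe *ℚ fi *ℚ (fem *ℚ fim))) ⟩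
      (ν m *ℚ z e i *ℚ (fe *ℚ fi *ℚ (fem *ℚ fim))) *ℚ (1ℚ *ℚ 1ℚ)
        ≡⟨ cong₂ (λ x y → (ν m *ℚ z e i *ℚ (fe *ℚ fi *ℚ (fem *ℚ fim))) *ℚ (x *ℚ y))
             (sym (fact*invFact (m + e + i))) (sym (fact*invFact m)) ⟩
      (ν m *ℚ z e i *ℚ (fe *ℚ fi *ℚ (fem *ℚ fim))) *ℚ ((fN *ℚ gN) *ℚ (fm *ℚ gm))
        ≡⟨ solve 10 (λ n fe fem gm z fi gN fim fN fm → (n :* z :* (fe :* fi :* (fem :* fim))) :* ((fN :* gN) :* (fm :* gm))
                    := ((n :* fe :* fem :* gm) :* (z :* (fi :* gN))) :* (fm :* fN :* fim)) refl
             (ν m) fe fem gm (z e i) fi gN fim fN fm ⟩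
      L *ℚ (fm *ℚ fN *ℚ fim)
        ≡⟨ cong (_*ℚ (fm *ℚ fN *ℚ fim)) eq ⟩
      R *ℚ (fm *ℚ fN *ℚ fim)
        ≡⟨ solve 6 (λ fie gim M fm fN fim → (fie :* (gim :* M)) :* (fm :* fN :* fim)
                    := (fim :* gim) :* (fN :* fm :* fie :* M)) refl fie gim (symSum m i e) fm fN fim ⟩
      (fim *ℚ gim) *ℚ (fN *ℚ fm *ℚ fie *ℚ symSum m i e)
        ≡⟨ cong (_*ℚ (fN *ℚ fm *ℚ fie *ℚ symSum m i e)) (fact*invFact (i + m)) ⟩
      1ℚ *ℚ (fN *ℚ fm *ℚ fie *ℚ symSum m i e)
        ≡⟨ ℚP.*-identityˡ (fN *ℚ fm *ℚ fie *ℚ symSum m i e) ⟩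
      fN *ℚ fm *ℚ fie *ℚ symSum m i e ∎

  claim-0 : ∀ i → 1 ≤ i → Claim 0 i
  claim-0 i 1≤i = begin
    ν m *ℚ z 0 i *ℚ (fact 0 *ℚ fact i *ℚ (fact m *ℚ fact (i + m)))
      ≡⟨ cong₂ (λ x y → ν m *ℚ x *ℚ (y *ℚ fact i *ℚ (fact m *ℚ fact (i + m)))) (trans (cong ι (Z-top 1≤i)) ι-1) ι-1 ⟩
    ν m *ℚ 1ℚ *ℚ (1ℚ *ℚ fact i *ℚ (fact m *ℚ fact (i + m)))
      ≡⟨ solve 4 (λ n a b c → n :* con 1ℚ :* (con 1ℚ :* a :* (b :* c)) := c :* b :* a :* n) refl (ν m) (fact i) (fact m) (fact (i + m)) ⟩
    fact (i + m) *ℚ fact m *ℚ fact i *ℚ ν m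
      ≡⟨ cong₂ (λ x y → fact x *ℚ fact m *ℚ fact y *ℚ ν m)
           (trans (ℕP.+-comm i m) (cong (_+ i) (sym (ℕP.+-identityʳ m)))) (sym (ℕP.+-identityʳ i)) ⟩
    fact (m + 0 + i) *ℚ fact m *ℚ fact (i + 0) *ℚ ν m
      ≡⟨ cong (fact (m + 0 + i) *ℚ fact m *ℚ fact (i + 0) *ℚ_) (sym (symSum-0 m i)) ⟩
    fact (m + 0 + i) *ℚ fact m *ℚ fact (i + 0) *ℚ symSum m i 0 ∎
    where
    open ≡-Reasoning
    open ℚSolver

  -- For i < e the claim is the symmetric instance (i, e); as both sides are polynomials in i of
  -- degree less than e after normalisation, these e values determine them.
  claim : ∀ e i → 1 ≤ e + i → Claim e i
  claim = <-rec _ step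
    where
    step : ∀ e → (∀ {e′} → e′ < e → ∀ i → 1 ≤ e′ + i → Claim e′ i) → ∀ i → 1 ≤ e + i → Claim e i
    step zero    IH i 1≤ = claim-0 i 1≤
    step (suc e) IH i 1≤ = Claim⇐ (suc e) i
      (DegLess-unique (suc e)
        (DegLess-*ˡ (suc e) (ν m *ℚ fact (suc e) *ℚ fact (suc e + m) *ℚ invFact m) (DegLess-z {suc e} (s≤s z≤n)))
        (DegLess-symSum m e)
        (λ i′ i′<e → Claim⇒ (suc e) i′
          (Claim-comm (ℕP.≤-trans (s≤s z≤n) (ℕP.m≤n+m (suc e) i′)) (IH i′<e (suc e) (ℕP.≤-trans (s≤s z≤n) (ℕP.m≤n+m (suc e) i′)))))
        i)

-- Back to the binomial coefficients of the statement

inv-unique : ∀ n x .{{_ : NonZero n}} → ν n *ℚ x ≡ 1ℚ → inv n ≡ x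
inv-unique n x eq = begin
  inv n                   ≡⟨ sym (ℚP.*-identityʳ (inv n)) ⟩
  inv n *ℚ 1ℚ             ≡⟨ cong (inv n *ℚ_) (sym eq) ⟩
  inv n *ℚ (ν n *ℚ x)     ≡⟨ solve 3 (λ a b c → a :* (b :* c) := (b :* a) :* c) refl (inv n) (ν n) x ⟩
  (ν n *ℚ inv n) *ℚ x     ≡⟨ cong (_*ℚ x) (ν*inv n) ⟩
  1ℚ *ℚ x                 ≡⟨ ℚP.*-identityˡ x ⟩
  x ∎
  where
  open ≡-Reasoning
  open ℚSolver

-- Peels off the largest factor where the definition peels off the smallest; the top of (i-1+h
-- choose h) grows together with h.
falling-suc : ∀ x h → falling (x +ℤ Z.+ 1) (suc h) ≡ (x +ℤ Z.+ 1) *ℤ falling x h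
falling-suc x zero    = solve 1 (λ x → con (Z.+ 1) :* ((x :+ con (Z.+ 1)) :- con (Z.+ 0)) := (x :+ con (Z.+ 1)) :* con (Z.+ 1)) refl x
  where open ℤSolver
falling-suc x (suc h) = trans (cong (_*ℤ ((x +ℤ Z.+ 1) -ℤ (Z.+ suc h))) (falling-suc x h))
  (trans (cong (λ y → (x +ℤ Z.+ 1) *ℤ falling x h *ℤ y)
    (trans (cong (λ y → (x +ℤ Z.+ 1) -ℤ y) (ℤP.pos-+ 1 h))
           (solve 2 (λ x h → (x :+ con (Z.+ 1)) :- (con (Z.+ 1) :+ h) := x :- h) refl x (Z.+ h))))
    (ℤP.*-assoc (x +ℤ Z.+ 1) (falling x h) (x -ℤ Z.+ h)))
  where open ℤSolver

-- At i = 0 the falling factorial starts from h - 1: it is the empty product for h = 0 and contains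
-- the factor 0 for h > 0, matching `multichoose 0`.
falling≡multichoose : ∀ i h → falling (Z.+ i -ℤ Z.+ 1 +ℤ Z.+ h) h ≡ Z.+ (multichoose i h * h !)
falling≡multichoose i zero    = refl
falling≡multichoose i (suc h) = begin
  falling (Z.+ i -ℤ Z.+ 1 +ℤ Z.+ suc h) (suc h)
    ≡⟨ cong (λ x → falling x (suc h)) (trans (cong (λ y → Z.+ i -ℤ Z.+ 1 +ℤ y) (ℤP.pos-+ 1 h))
         (solve 2 (λ i h → i :- con (Z.+ 1) :+ (con (Z.+ 1) :+ h) := i :- con (Z.+ 1) :+ h :+ con (Z.+ 1)) refl (Z.+ i) (Z.+ h))) ⟩
  falling (x +ℤ Z.+ 1) (suc h)
    ≡⟨ falling-suc x h ⟩
  (x +ℤ Z.+ 1) *ℤ falling x h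
    ≡⟨ cong₂ _*ℤ_ (trans (solve 2 (λ i h → i :- con (Z.+ 1) :+ h :+ con (Z.+ 1) := i :+ h) refl (Z.+ i) (Z.+ h)) (sym (ℤP.pos-+ i h)))
         (falling≡multichoose i h) ⟩
  Z.+ (i + h) *ℤ Z.+ (multichoose i h * h !)
    ≡⟨ sym (ℤP.pos-* (i + h) (multichoose i h * h !)) ⟩
  Z.+ ((i + h) * (multichoose i h * h !))
    ≡⟨ cong Z.+_ (begin
         (i + h) * (multichoose i h * h !)        ≡⟨ sym (ℕP.*-assoc (i + h) (multichoose i h) (h !)) ⟩
         (i + h) * multichoose i h * h !          ≡⟨ cong (_* h !) (sym (multichoose-suc i h)) ⟩
         suc h * multichoose i (suc h) * h !      ≡⟨ cong (_* h !) (ℕP.*-comm (suc h) (multichoose i (suc h))) ⟩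
         multichoose i (suc h) * suc h * h !      ≡⟨ ℕP.*-assoc (multichoose i (suc h)) (suc h) (h !) ⟩
         multichoose i (suc h) * (suc h) ! ∎) ⟩
  Z.+ (multichoose i (suc h) * (suc h) !) ∎
  where
  open ≡-Reasoning
  open ℤSolver
  x = Z.+ i -ℤ Z.+ 1 +ℤ Z.+ h

binom≡W : ∀ i h → binom (Z.+ i -ℤ Z.+ 1 +ℤ Z.+ h) h ≡ W i h
binom≡W i h = begin
  ℤtoℚ (falling x h) ÷ℕ (h !)              ≡⟨ ÷ℕ≡*inv (ℤtoℚ (falling x h)) (h !) ⟩
  ℤtoℚ (falling x h) *ℚ invFact h          ≡⟨ cong (_*ℚ invFact h) (trans (ι≡ (falling x h)) (cong ι (falling≡multichoose i h))) ⟩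
  ν (multichoose i h * h !) *ℚ invFact h   ≡⟨ cong (_*ℚ invFact h) (ν-* (multichoose i h) (h !)) ⟩
  (W i h *ℚ fact h) *ℚ invFact h           ≡⟨ ℚP.*-assoc (W i h) (fact h) (invFact h) ⟩
  W i h *ℚ (fact h *ℚ invFact h)           ≡⟨ cong (W i h *ℚ_) (fact*invFact h) ⟩
  W i h *ℚ 1ℚ                              ≡⟨ ℚP.*-identityʳ (W i h) ⟩
  W i h ∎
  where
  open ≡-Reasoning
  x = Z.+ i -ℤ Z.+ 1 +ℤ Z.+ h

-- By `multichoose-suc`, (h+1) (W i (h+1) - W i h) = (i-1) W i h. Hence (h+1) m times the right side
-- is (i (h+1) - m (i-1)) W i h, and this factor is the numerator i (h-m+1) + m.
weight≡ : ∀ m i h → .{{_ : NonZero m}} →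
  (ℤtoℚ (Z.+ i *ℤ (Z.+ h -ℤ Z.+ m +ℤ Z.+ 1) +ℤ Z.+ m) ÷ℕ ((h + 1) * m)) *ℚ W i h
  ≡ inv m *ℚ (ν i *ℚ W i h -ℚ ν m *ℚ (W i (suc h) -ℚ W i h))
weight≡ m i h = begin
  (ℤtoℚ a ÷ℕ ((h + 1) * m)) *ℚ W i h
    ≡⟨ cong (_*ℚ W i h) (trans (÷ℕ≡*inv (ℤtoℚ a) ((h + 1) * m)) (cong₂ _*ℚ_ (trans (ι≡ a) ι-a) inv≡)) ⟩
  ((ν i *ℚ (ν h -ℚ ν m +ℚ 1ℚ) +ℚ ν m) *ℚ (inv (suc h) *ℚ inv m)) *ℚ W i h
    ≡⟨ solve 6 (λ i h m s t w → ((i :* (h :- m :+ con 1ℚ) :+ m) :* (s :* t)) :* w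
         := (t :* s) :* (i :* ((con 1ℚ :+ h) :* w) :- m :* ((i :+ h) :* w :- (con 1ℚ :+ h) :* w))) refl
         (ν i) (ν h) (ν m) (inv (suc h)) (inv m) (W i h) ⟩
  (inv m *ℚ inv (suc h)) *ℚ (ν i *ℚ ((1ℚ +ℚ ν h) *ℚ W i h) -ℚ ν m *ℚ ((ν i +ℚ ν h) *ℚ W i h -ℚ (1ℚ +ℚ ν h) *ℚ W i h))
    ≡⟨ cong₂ (λ x y → (inv m *ℚ inv (suc h)) *ℚ (ν i *ℚ (x *ℚ W i h) -ℚ ν m *ℚ (y -ℚ x *ℚ W i h)))
         (sym (ν-suc h)) (trans (cong (_*ℚ W i h) (sym (ν-+ i h))) (sym (W-suc i h))) ⟩
  (inv m *ℚ inv (suc h)) *ℚ (ν i *ℚ (ν (suc h) *ℚ W i h) -ℚ ν m *ℚ (ν (suc h) *ℚ W i (suc h) -ℚ ν (suc h) *ℚ W i h))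
    ≡⟨ solve 7 (λ t s n i m w w′ → (t :* s) :* (i :* (n :* w) :- m :* (n :* w′ :- n :* w))
         := (n :* s) :* (t :* (i :* w :- m :* (w′ :- w)))) refl
         (inv m) (inv (suc h)) (ν (suc h)) (ν i) (ν m) (W i h) (W i (suc h)) ⟩
  (ν (suc h) *ℚ inv (suc h)) *ℚ (inv m *ℚ (ν i *ℚ W i h -ℚ ν m *ℚ (W i (suc h) -ℚ W i h)))
    ≡⟨ cong (_*ℚ (inv m *ℚ (ν i *ℚ W i h -ℚ ν m *ℚ (W i (suc h) -ℚ W i h)))) (ν*inv (suc h)) ⟩
  1ℚ *ℚ (inv m *ℚ (ν i *ℚ W i h -ℚ ν m *ℚ (W i (suc h) -ℚ W i h)))
    ≡⟨ ℚP.*-identityˡ _ ⟩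
  inv m *ℚ (ν i *ℚ W i h -ℚ ν m *ℚ (W i (suc h) -ℚ W i h)) ∎
  where
  open ≡-Reasoning
  open ℚSolver
  b = Z.+ h -ℤ Z.+ m +ℤ Z.+ 1
  a = Z.+ i *ℤ b +ℤ Z.+ m

  ι-a : ι a ≡ ν i *ℚ (ν h -ℚ ν m +ℚ 1ℚ) +ℚ ν m
  ι-a = trans (ι-+ (Z.+ i *ℤ b) (Z.+ m)) (cong (_+ℚ ν m) (trans (ι-* (Z.+ i) b) (cong (ν i *ℚ_)
    (trans (ι-+ (Z.+ h -ℤ Z.+ m) (Z.+ 1)) (cong₂ _+ℚ_
      (trans (ι-+ (Z.+ h) (-ℤ (Z.+ m))) (cong (ν h +ℚ_) (ι-neg (Z.+ m)))) ι-1)))))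

  inv≡ : inv ((h + 1) * m) ≡ inv (suc h) *ℚ inv m
  inv≡ = trans (cong (λ x → inv (x * m)) (ℕP.+-comm h 1))
    (inv-unique (suc h * m) (inv (suc h) *ℚ inv m) {{ℕP.m*n≢0 (suc h) m}}
      (trans (cong (_*ℚ (inv (suc h) *ℚ inv m)) (ν-* (suc h) m))
      (trans (solve 4 (λ a b c d → (a :* b) :* (c :* d) := (a :* c) :* (b :* d)) refl (ν (suc h)) (ν m) (inv (suc h)) (inv m))
      (trans (cong₂ _*ℚ_ (ν*inv (suc h)) (ν*inv m)) (ℚP.*-identityˡ 1ℚ)))))

sumℚ≡symSum : ∀ m e i → .{{_ : NonZero m}} →
  sumℚ (map (λ h → (ℤtoℚ (Z.+ i *ℤ (Z.+ h -ℤ Z.+ m +ℤ Z.+ 1) +ℤ Z.+ m) ÷ℕ ((h + 1) * m))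
                   *ℚ binom (Z.+ i -ℤ Z.+ 1 +ℤ Z.+ h) h
                   *ℚ binom (Z.+ (e + i) -ℤ Z.+ i +ℤ Z.+ h) h) (upTo m))
  ≡ inv m *ℚ symSum m i e
sumℚ≡symSum m e i = begin
  sumℚ (map F (upTo m))
    ≡⟨ sumℚ≡Sum m F ⟩
  Sum m F
    ≡⟨ Sum-cong m (λ h _ → trans
         (cong₂ (λ x y → (ℤtoℚ (Z.+ i *ℤ (Z.+ h -ℤ Z.+ m +ℤ Z.+ 1) +ℤ Z.+ m) ÷ℕ ((h + 1) * m)) *ℚ x *ℚ y)
           (binom≡W i h) (trans (cong (λ x → binom x h) (e+i-i h)) (binom≡W (suc e) h)))
         (trans (cong (_*ℚ W (suc e) h) (weight≡ m i h)) (ℚP.*-assoc (inv m) _ (W (suc e) h)))) ⟩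
  Sum m (λ h → inv m *ℚ ((ν i *ℚ W i h -ℚ ν m *ℚ (W i (suc h) -ℚ W i h)) *ℚ W (suc e) h))
    ≡⟨ Sum-*ˡ m (inv m) (λ h → (ν i *ℚ W i h -ℚ ν m *ℚ (W i (suc h) -ℚ W i h)) *ℚ W (suc e) h) ⟩
  inv m *ℚ Sum m (λ h → (ν i *ℚ W i h -ℚ ν m *ℚ (W i (suc h) -ℚ W i h)) *ℚ W (suc e) h)
    ≡⟨ cong (inv m *ℚ_) (Sum≡symSum i e m) ⟩
  inv m *ℚ symSum m i e ∎
  where
  open ≡-Reasoning
  F : ℕ → ℚ
  F h = (ℤtoℚ (Z.+ i *ℤ (Z.+ h -ℤ Z.+ m +ℤ Z.+ 1) +ℤ Z.+ m) ÷ℕ ((h + 1) * m))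
        *ℚ binom (Z.+ i -ℤ Z.+ 1 +ℤ Z.+ h) h
        *ℚ binom (Z.+ (e + i) -ℤ Z.+ i +ℤ Z.+ h) h

  -- The top d - i + h carries no -1, so in the form i - 1 + h its parameter is e + 1; this is why
  -- `W (suc e)` faces `W i`.
  e+i-i : ∀ h → Z.+ (e + i) -ℤ Z.+ i +ℤ Z.+ h ≡ Z.+ suc e -ℤ Z.+ 1 +ℤ Z.+ h
  e+i-i h = trans (cong (λ x → x -ℤ Z.+ i +ℤ Z.+ h) (ℤP.pos-+ e i))
    (trans (solve 3 (λ e i h → (e :+ i) :- i :+ h := (con (Z.+ 1) :+ e) :- con (Z.+ 1) :+ h) refl (Z.+ e) (Z.+ i) (Z.+ h))
           (cong (λ x → x -ℤ Z.+ 1 +ℤ Z.+ h) (sym (ℤP.pos-+ 1 e))))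
    where open ℤSolver

module _ (m e i : ℕ) where
  private
    N = e + i + m
    open ≡-Reasoning

  C-i+m : νC N (i + m) ≡ fact N *ℚ (invFact (i + m) *ℚ invFact e)
  C-i+m = subst (λ x → νC x (i + m) ≡ fact x *ℚ (invFact (i + m) *ℚ invFact e))
    (trans (ℕP.+-comm (i + m) e) (sym (ℕP.+-assoc e i m))) (ν-C (i + m) e)

  C-i : νC N i ≡ fact N *ℚ (invFact i *ℚ invFact (e + m))
  C-i = subst (λ x → νC x i ≡ fact x *ℚ (invFact i *ℚ invFact (e + m)))
    (trans (sym (ℕP.+-assoc i e m)) (cong (_+ m) (ℕP.+-comm i e))) (ν-C i (e + m))

  C-m : νC N m ≡ fact N *ℚ (invFact m *ℚ invFact (i + e))
  C-m = subst (λ x → νC x m ≡ fact x *ℚ (invFact m *ℚ invFact (i + e)))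
    (trans (ℕP.+-comm m (i + e)) (cong (_+ m) (ℕP.+-comm i e))) (ν-C m (i + e))

  inv-C-m : inv (N C m) ≡ invFact N *ℚ (fact m *ℚ fact (i + e))
  inv-C-m = inv-unique (N C m) _ {{C≢0 (N C m) refl}} unit
    where
    open ℚSolver
    unit : νC N m *ℚ (invFact N *ℚ (fact m *ℚ fact (i + e))) ≡ 1ℚ
    unit = begin
      νC N m *ℚ (invFact N *ℚ (fact m *ℚ fact (i + e)))
        ≡⟨ cong (_*ℚ (invFact N *ℚ (fact m *ℚ fact (i + e)))) C-m ⟩
      (fact N *ℚ (invFact m *ℚ invFact (i + e))) *ℚ (invFact N *ℚ (fact m *ℚ fact (i + e)))
        ≡⟨ solve 6 (λ a b c d e f → (a :* (b :* c)) :* (d :* (e :* f)) := (a :* d) :* ((e :* b) :* (f :* c))) refl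
             (fact N) (invFact m) (invFact (i + e)) (invFact N) (fact m) (fact (i + e)) ⟩
      (fact N *ℚ invFact N) *ℚ ((fact m *ℚ invFact m) *ℚ (fact (i + e) *ℚ invFact (i + e)))
        ≡⟨ cong₂ _*ℚ_ (fact*invFact N) (cong₂ _*ℚ_ (fact*invFact m) (fact*invFact (i + e))) ⟩
      1ℚ *ℚ (1ℚ *ℚ 1ℚ)
        ≡⟨⟩
      1ℚ ∎
    -- `unit` exhibits an inverse of the binomial coefficient; if it were 0, then 1 = 0 would
    -- follow.
    C≢0 : ∀ c → N C m ≡ c → NonZero c
    C≢0 (suc c) _ = _
    C≢0 zero eq = contradiction (trans (sym unit) (trans (cong (_*ℚ (invFact N *ℚ (fact m *ℚ fact (i + e)))) (trans (cong ν eq) ι-0)) (ℚP.*-zeroˡ (invFact N *ℚ (fact m *ℚ fact (i + e)))))) λ ()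

Z-formula : (P : Mat → Poly) → IsKL P → (m e i : ℕ) → 1 ≤ m → 1 ≤ e + i →
  ℤtoℚ (Z P (U m (e + i)) i) ≡
    ((ℤtoℚ (Z.+ ((e + i + m) C (i + m))) *ℚ ℤtoℚ (Z.+ ((e + i + m) C i))) ÷ℕ ((e + i + m) C m))
    *ℚ sumℚ (map (λ h → (ℤtoℚ (Z.+ i *ℤ (Z.+ h -ℤ Z.+ m +ℤ Z.+ 1) +ℤ Z.+ m) ÷ℕ ((h + 1) * m))
                     *ℚ binom (Z.+ i -ℤ Z.+ 1 +ℤ Z.+ h) h
                     *ℚ binom (Z.+ (e + i) -ℤ Z.+ i +ℤ Z.+ h) h) (upTo m))
Z-formula P isKL m@(suc _) e i 1≤m 1≤e+i = sym (begin
  ((ℤtoℚ (Z.+ (N C (i + m))) *ℚ ℤtoℚ (Z.+ (N C i))) ÷ℕ (N C m)) *ℚ S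
    ≡⟨ cong₂ _*ℚ_ (÷ℕ≡*inv (ℤtoℚ (Z.+ (N C (i + m))) *ℚ ℤtoℚ (Z.+ (N C i))) (N C m)) (sumℚ≡symSum m e i) ⟩
  (ℤtoℚ (Z.+ (N C (i + m))) *ℚ ℤtoℚ (Z.+ (N C i))) *ℚ inv (N C m) *ℚ (inv m *ℚ symSum m i e)
    ≡⟨ cong₂ (λ x y → x *ℚ y *ℚ (inv m *ℚ symSum m i e))
         (cong₂ _*ℚ_ (trans (ι≡ (Z.+ (N C (i + m)))) (C-i+m m e i)) (trans (ι≡ (Z.+ (N C i))) (C-i m e i)))
         (inv-C-m m e i) ⟩
  ((fN *ℚ (gim *ℚ ge)) *ℚ (fN *ℚ (gi *ℚ gem))) *ℚ (gN *ℚ (fm *ℚ fie)) *ℚ (inv m *ℚ symSum m i e)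
    ≡⟨ solve 10 (λ fN gN gim ge gi gem fm fie n M → ((fN :* (gim :* ge)) :* (fN :* (gi :* gem))) :* (gN :* (fm :* fie)) :* (n :* M)
         := (fN :* fm :* fie :* M) :* ((fN :* gN) :* (gim :* ge :* gi :* gem :* n))) refl
         fN gN gim ge gi gem fm fie (inv m) (symSum m i e) ⟩
  (fN *ℚ fm *ℚ fie *ℚ symSum m i e) *ℚ ((fN *ℚ gN) *ℚ (gim *ℚ ge *ℚ gi *ℚ gem *ℚ inv m))
    ≡⟨ cong₂ (λ x y → x *ℚ (y *ℚ (gim *ℚ ge *ℚ gi *ℚ gem *ℚ inv m)))
         (trans (cong (λ x → fact x *ℚ fm *ℚ fie *ℚ symSum m i e) N≡) (sym (claim e i 1≤e+i))) (fact*invFact N) ⟩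
  (ν m *ℚ z e i *ℚ (fe *ℚ fi *ℚ (fem *ℚ fim))) *ℚ (1ℚ *ℚ (gim *ℚ ge *ℚ gi *ℚ gem *ℚ inv m))
    ≡⟨ solve 11 (λ n z fe fi fem fim gim ge gi gem n⁻¹ → (n :* z :* (fe :* fi :* (fem :* fim))) :* (con 1ℚ :* (gim :* ge :* gi :* gem :* n⁻¹))
         := z :* ((n :* n⁻¹) :* ((fe :* ge) :* (fi :* gi)) :* ((fem :* gem) :* (fim :* gim)))) refl
         (ν m) (z e i) fe fi fem fim gim ge gi gem (inv m) ⟩
  z e i *ℚ ((ν m *ℚ inv m) *ℚ ((fe *ℚ ge) *ℚ (fi *ℚ gi)) *ℚ ((fem *ℚ gem) *ℚ (fim *ℚ gim)))
    ≡⟨ cong (z e i *ℚ_) (cong₂ _*ℚ_ (cong₂ _*ℚ_ (ν*inv m) (cong₂ _*ℚ_ (fact*invFact e) (fact*invFact i)))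
                                   (cong₂ _*ℚ_ (fact*invFact (e + m)) (fact*invFact (i + m)))) ⟩
  z e i *ℚ (1ℚ *ℚ (1ℚ *ℚ 1ℚ) *ℚ (1ℚ *ℚ 1ℚ))
    ≡⟨ ℚP.*-identityʳ (z e i) ⟩
  z e i
    ≡⟨ sym (ι≡ (Z P (U m (e + i)) i)) ⟩
  ℤtoℚ (Z P (U m (e + i)) i) ∎)
  where
  open ≡-Reasoning
  open ℚSolver
  open Formula P isKL m 1≤m
  N = e + i + m
  S = sumℚ (map (λ h → (ℤtoℚ (Z.+ i *ℤ (Z.+ h -ℤ Z.+ m +ℤ Z.+ 1) +ℤ Z.+ m) ÷ℕ ((h + 1) * m))
                     *ℚ binom (Z.+ i -ℤ Z.+ 1 +ℤ Z.+ h) h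
                     *ℚ binom (Z.+ (e + i) -ℤ Z.+ i +ℤ Z.+ h) h) (upTo m))
  fe = fact e
  ge = invFact e
  fi = fact i
  gi = invFact i
  fem = fact (e + m)
  gem = invFact (e + m)
  fim = fact (i + m)
  gim = invFact (i + m)
  fN = fact N
  gN = invFact N
  fm = fact m
  fie = fact (i + e)
  N≡ : N ≡ m + e + i
  N≡ = trans (ℕP.+-comm (e + i) m) (sym (ℕP.+-assoc m e i))

theorem1p6 : (P : Mat → Poly) → IsKL P →
    (m d : ℕ) → 1 ≤ m → 1 ≤ d → (i : ℕ) → i ≤ d →
    ℤtoℚ (Z P (U m d) i) ≡
    ((ℤtoℚ (Z.+ ((d + m) C (i + m))) Q.* ℤtoℚ (Z.+ ((d + m) C i))) ÷ℕ ((d + m) C m))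
    Q.* sumℚ (map (λ h → (ℤtoℚ (Z.+ i Z.* (Z.+ h Z.- Z.+ m Z.+ Z.+ 1) Z.+ Z.+ m) ÷ℕ ((h + 1) * m))
    Q.* binom (Z.+ i Z.- Z.+ 1 Z.+ Z.+ h) h
    Q.* binom (Z.+ d Z.- Z.+ i Z.+ Z.+ h) h)
    (upTo m))
theorem1p6 P isKL m d 1≤m 1≤d i i≤d =
  subst (λ d → ℤtoℚ (Z P (U m d) i) ≡
    ((ℤtoℚ (Z.+ ((d + m) C (i + m))) Q.* ℤtoℚ (Z.+ ((d + m) C i))) ÷ℕ ((d + m) C m))
    Q.* sumℚ (map (λ h → (ℤtoℚ (Z.+ i Z.* (Z.+ h Z.- Z.+ m Z.+ Z.+ 1) Z.+ Z.+ m) ÷ℕ ((h + 1) * m))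
    Q.* binom (Z.+ i Z.- Z.+ 1 Z.+ Z.+ h) h
    Q.* binom (Z.+ d Z.- Z.+ i Z.+ Z.+ h) h)
    (upTo m)))
    (ℕP.m∸n+n≡m i≤d)
    (Z-formula P isKL m (d ∸ i) i 1≤m (ℕP.≤-trans 1≤d (ℕP.≤-reflexive (sym (ℕP.m∸n+n≡m i≤d)))))
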